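{- Let $\delta \in \mathbb{N}$ be such that $\delta-1$ is a prime power. Then there exists an infinite family of bipartite $C_4$-free graphs $G$, each of order $n$ (depending on $G$) and minimum degree $\delta$, such that \[ \operatorname{avec}(G) \geq \frac{9n}{2\delta^*} - 5, \] where $\delta^* = 2\delta^2-2\delta+2$.
   Context: All graphs are finite and simple. For a connected graph $G$, the eccentricity $e_G(v)$ of a vertex $v$ is $\max_{w\in V(G)} d_G(v,w)$, where $d_G$ is the shortest-path distance, and the average eccentricity is $\operatorname{avec}(G)=\frac{1}{n}\sum_{v\in V(G)} e_G(v)$ with $n=|V(G)|$ (the graphs in the family are connected). A graph is $C_4$-free if it contains no cycle of length $4$ as a (not necessarily induced) subgraph. -}

module Defs where

open import Data.Nat using (ℕ; zero; suc; _+_; _*_; _∸_; _^_; _≤_; _⊔_)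
open import Data.Nat.Primality using (Prime)
open import Data.Fin using (Fin)
open import Data.Bool using (Bool; true; false; if_then_else_; _∨_; _∧_; not)
open import Data.List using (List; map; foldr; allFin; filter; length)
open import Data.Bool.ListAction using (any)
open import Data.Nat.ListAction using (sum)
open import Data.Fin using (_≟_)
open import Relation.Nullary.Decidable using (⌊_⌋)
open import Data.Product using (Σ; ∃; _×_; _,_)
open import Relation.Binary.PropositionalEquality using (_≡_; _≢_)
open import Relation.Nullary using (¬_)
open import Data.Bool.Properties using (T?)

record Graph (n : ℕ) : Set where
  field
    adj    : Fin n → Fin n → Bool
    sym    : ∀ u v → adj u v ≡ adj v u
    irrefl : ∀ v → adj v v ≡ false
open Graph public

module _ {n : ℕ} (G : Graph n) where

  deg : Fin n → ℕ
  deg v = length (filter (λ w → T? (adj G v w)) (allFin n))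

  MinDegree : ℕ → Set
  MinDegree δ = (∀ v → δ ≤ deg v) × ∃ λ v → deg v ≡ δ

  reach : ℕ → Fin n → Fin n → Bool
  reach zero    v w = ⌊ v ≟ w ⌋
  reach (suc k) v w = reach k v w ∨ any (λ u → reach k v u ∧ adj G u w) (allFin n)

  Connected : Set
  Connected = ∀ v w → ∃ λ k → reach k v w ≡ true

  -- shortest-path distance: least k ≤ n with reach k v w (n if unreachable;
  -- irrelevant for connected graphs)
  dist : Fin n → Fin n → ℕ
  dist v w = search 0 n
    where
      search : ℕ → ℕ → ℕ
      search k zero    = k
      search k (suc f) = if reach k v w then k else search (suc k) f

  ecc : Fin n → ℕ
  ecc v = foldr _⊔_ 0 (map (dist v) (allFin n))

  -- sum of eccentricities, so avec G = sumEcc / n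
  sumEcc : ℕ
  sumEcc = sum (map ecc (allFin n))

  Bipartite : Set
  Bipartite = ∃ λ (c : Fin n → Bool) → ∀ u v → adj G u v ≡ true → c u ≢ c v

  C4Free : Set
  C4Free = ¬ (∃ λ a → ∃ λ b → ∃ λ c → ∃ λ d →
      a ≢ b × a ≢ c × a ≢ d × b ≢ c × b ≢ d × c ≢ d ×
      adj G a b ≡ true × adj G b c ≡ true × adj G c d ≡ true × adj G d a ≡ true)

PrimePower : ℕ → Set
PrimePower q = ∃ λ p → ∃ λ k → Prime p × 1 ≤ k × q ≡ p ^ k

δstar : ℕ → ℕ
δstar δ = 2 * δ * δ ∸ 2 * δ + 2

{-# OPTIONS --safe #-}

-- Let q = δ - 1.  The incidence graph of a projective plane of order q is bipartite, C₄-free, (q+1)-regular and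
-- has δ* vertices.  Deleting one of its edges puts the two ends of that edge at distance 5, so a chain of k copies
-- of this graph joined end to end is 6k + O(1) long and has kδ* vertices, which gives average eccentricity
-- 3/4 · 6k + O(1).  Distances are bounded from below by a 1-Lipschitz potential.
--
-- The plane is coordinatised by a field with p^k elements, obtained as F[X]/(f) for F = ℤ/p.  An irreducible f of
-- degree k exists because X^(p^k) - X is squarefree and its irreducible factors have degree at most k, while
-- those of degree d < k divide X^(p^d) - X, and the product of these polynomials over d < k has degree less than p^k.
-- Quotients are commutative rings with a coarser setoid equality on the same carrier.
module Submission where

open import Algebra.Bundles using (CommutativeRing)
import Algebra.Properties.Semiring.Exp as Exp
import Algebra.Properties.Semiring.Mult as Mult
open import Data.Bool using (Bool; true; false; T; _∧_; if_then_else_)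
open import Data.Bool.Properties using (T?; T-≡; T-∧; T-∨)
open import Data.Empty using (⊥)
open import Data.Fin as Fin using (Fin; zero; suc; toℕ; fromℕ; inject₁; punchIn; _↑ˡ_; _↑ʳ_)
open import Data.Fin.Induction using (<-weakInduction)
open import Data.Fin.Permutation using (Permutation′; _⟨$⟩ʳ_; permutation)
import Data.Fin.Properties as Fin
import Data.Integer as ℤ
import Data.Integer.DivMod as ℤ
import Data.Integer.Properties as ℤ
open import Data.List as List using (List; []; _∷_; allFin; filter; foldr)
open import Data.List.Membership.Propositional using (_∈_)
open import Data.List.Membership.Propositional.Properties using (∈-filter⁺; ∈-filter⁻; ∈-allFin; ∈-lookup)
import Data.List.Properties as List
import Data.List.Relation.Unary.All as All
open import Data.List.Relation.Unary.AllPairs using (_∷_)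
import Data.List.Relation.Unary.Any as Any
open import Data.List.Relation.Unary.Any using (here; there)
open import Data.List.Relation.Unary.Any.Properties using (any⁺; any⁻; lookup-index)
open import Data.List.Relation.Unary.Unique.Propositional using (Unique)
open import Data.List.Relation.Unary.Unique.Propositional.Properties using (filter⁺; allFin⁺)
open import Data.Nat as ℕ using (ℕ; zero; suc; _∸_; _≤_; _<_; z≤n; s≤s; _⊔_)
open import Data.Nat.Combinatorics using (_C_; nCn≡1; nC1≡n; nCk≡nC[n∸k]; nCk+nC[k+1]≡[n+1]C[k+1])
open import Data.Nat.Combinatorics.Specification using (k>n⇒nCk≡0)
import Data.Nat.Divisibility as ℕ∣
open import Data.Nat.Primality using (Prime; euclidsLemma; prime⇒nonTrivial; prime⇒nonZero)
import Data.Nat.Properties as ℕ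
import Data.Nat.Solver as ℕ-Solver
open import Data.Product using (Σ; ∃; _×_; _,_; proj₁; proj₂)
open import Data.Product.Function.NonDependent.Propositional using (_×-↔_)
open import Data.Sum as Sum using (_⊎_; inj₁; inj₂; [_,_]′)
open import Data.Sum.Function.Propositional using (_⊎-↔_)
open import Data.Unit using (⊤; tt)
open import Data.Vec as Vec using (Vec; []; _∷_)
open import Data.Vec.Functional using (Vector; replicate; removeAt; tail; init)
open import Function using (_∘_; id; _↔_; Inverse; Equivalence; mk↔ₛ′)
open import Function.Properties.Inverse using (↔-refl; ↔-trans)
open import Level using (0ℓ)
open import Relation.Binary.Construct.Closure.ReflexiveTransitive using (Star; ε; _◅_; _◅◅_; reverse)
open import Relation.Binary.PropositionalEquality as ≡ using (_≡_; _≢_; _≗_)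
open import Relation.Nullary using (¬_; Dec; yes; no; contradiction)
open import Relation.Nullary.Decidable using (isYes; map′; toWitness; fromWitness; _×-dec_; _⊎-dec_)

-- The incidence graph of a projective plane has girth 6, so the ends of a deleted edge are 5 apart
-- along the rest of a hexagon; the edge to the next copy adds 1, which makes 6 per copy. In an
-- inner copy each of the two elements at infinity loses one edge and gains one; in the end copies
-- their common edge is kept, since otherwise the outermost element at infinity would have degree q
-- only. The constant 5 is the whole cost of the two ends. With 2j copies, the copies a and j + a (a
-- < j) have eccentricities at least 12j - 6a - 8 and 6(j + a) - 2, together 18j - 10. The mean is
-- therefore at least 9j - 5, and 9j = 9n/(2δ*). Both facts about A = X^(p^k) - X come from one
-- congruence: by Frobenius, g^(p^k) = g modulo A for every polynomial g. It is applied modulo f²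
-- for squarefreeness and modulo f for the bound on degrees.

-- Quotients of commutative rings by a principal ideal

module Quotient (R : CommutativeRing 0ℓ 0ℓ) (c : CommutativeRing.Carrier R) where
  open CommutativeRing R hiding (zero)
  open import Algebra.Properties.Ring ring using (-‿distribˡ-*; -‿+-comm)
  open import Algebra.Solver.Ring.NaturalCoefficients.Default commutativeSemiring

  infix 4 _~_
  -- A record type lets unification recover a and b from the type of a congruence, which an
  -- unfolding Σ-type would not.
  record _~_ (a b : Carrier) : Set where
    constructor _,_
    field
      multiplier : Carrier
      equality   : a ≈ b + multiplier * c

  ≈⇒~ : ∀ {a b} → a ≈ b → a ~ b
  ≈⇒~ {a} {b} a≈b = 0# , trans a≈b (solve 2 (λ b c → b := b :+ con 0 :* c) refl b c)

  ~-sym : ∀ {a b} → a ~ b → b ~ a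
  ~-sym {a} {b} (q , eq) = - q , sym (begin
    a + - q * c            ≈⟨ +-cong eq (sym (-‿distribˡ-* q c)) ⟩
    (b + q * c) - q * c    ≈⟨ +-assoc b _ _ ⟩
    b + (q * c - q * c)    ≈⟨ +-congˡ (-‿inverseʳ _) ⟩
    b + 0#                 ≈⟨ +-identityʳ b ⟩
    b                      ∎)
    where open import Relation.Binary.Reasoning.Setoid setoid

  ~-trans : ∀ {a b d} → a ~ b → b ~ d → a ~ d
  ~-trans {a} {b} {d} (q , eq) (r , eq′) = r + q ,
    trans (trans eq (+-congʳ eq′)) (solve 4 (λ d r q c → (d :+ r :* c) :+ q :* c := d :+ (r :+ q) :* c) refl d r q c)

  +-cong~ : ∀ {a b a′ b′} → a ~ b → a′ ~ b′ → a + a′ ~ b + b′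
  +-cong~ {a} {b} {a′} {b′} (q , eq) (r , eq′) = q + r ,
    trans (+-cong eq eq′) (solve 5 (λ b b′ r q c → (b :+ q :* c) :+ (b′ :+ r :* c) := (b :+ b′) :+ (q :+ r) :* c) refl b b′ r q c)

  *-cong~ : ∀ {a b a′ b′} → a ~ b → a′ ~ b′ → a * a′ ~ b * b′
  *-cong~ {a} {b} {a′} {b′} (q , eq) (r , eq′) = b * r + b′ * q + q * r * c ,
    trans (*-cong eq eq′) (solve 5 (λ b b′ r q c → (b :+ q :* c) :* (b′ :+ r :* c) := b :* b′ :+ (b :* r :+ b′ :* q :+ q :* r :* c) :* c) refl b b′ r q c)

  -‿cong~ : ∀ {a b} → a ~ b → - a ~ - b
  -‿cong~ {a} {b} (q , eq) = - q , trans (-‿cong eq) (trans (sym (-‿+-comm b (q * c))) (+-congˡ (-‿distribˡ-* q c)))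

  quotientRing : CommutativeRing 0ℓ 0ℓ
  quotientRing = record
    { Carrier = Carrier ; _≈_ = _~_ ; _+_ = _+_ ; _*_ = _*_ ; -_ = -_ ; 0# = 0# ; 1# = 1#
    ; isCommutativeRing = record
      { isRing = record
        { +-isAbelianGroup = record
          { isGroup = record
            { isMonoid = record
              { isSemigroup = record
                { isMagma = record
                  { isEquivalence = record { refl = ≈⇒~ refl ; sym = ~-sym ; trans = ~-trans }
                  ; ∙-cong = +-cong~ }
                ; assoc = λ a b d → ≈⇒~ (+-assoc a b d) }
              ; identity = (λ a → ≈⇒~ (+-identityˡ a)) , (λ a → ≈⇒~ (+-identityʳ a)) }
            ; inverse = (λ a → ≈⇒~ (-‿inverseˡ a)) , (λ a → ≈⇒~ (-‿inverseʳ a))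
            ; ⁻¹-cong = -‿cong~ }
          ; comm = λ a b → ≈⇒~ (+-comm a b) }
        ; *-cong = *-cong~
        ; *-assoc = λ a b d → ≈⇒~ (*-assoc a b d)
        ; *-identity = (λ a → ≈⇒~ (*-identityˡ a)) , (λ a → ≈⇒~ (*-identityʳ a))
        ; distrib = (λ a b d → ≈⇒~ (distribˡ a b d)) , (λ a b d → ≈⇒~ (distribʳ a b d)) }
      ; *-comm = λ a b → ≈⇒~ (*-comm a b) } }

-- Binomial coefficients modulo p and the Frobenius map

nC0≡1 : ∀ n → n C 0 ≡ 1
nC0≡1 n = ≡.trans (nCk≡nC[n∸k] {0} {n} z≤n) (nCn≡1 n)

-- Pascal's rule reduces the identity to its instances at (n, k) and (n, k + 1). Its use is to
-- exhibit a factor p in k · C(p, k).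
absorption : ∀ n k → suc k ℕ.* (suc n C suc k) ≡ suc n ℕ.* (n C k)
absorption n zero = begin
  1 ℕ.* (suc n C 1)      ≡⟨ ℕ.*-identityˡ _ ⟩
  suc n C 1              ≡⟨ nC1≡n (suc n) ⟩
  suc n                  ≡⟨ ℕ.*-identityʳ (suc n) ⟨
  suc n ℕ.* 1            ≡⟨ ≡.cong (suc n ℕ.*_) (nC0≡1 n) ⟨
  suc n ℕ.* (n C 0)      ∎
  where open ≡.≡-Reasoning
absorption zero (suc k) = begin
  suc (suc k) ℕ.* (1 C suc (suc k))  ≡⟨ ≡.cong (suc (suc k) ℕ.*_) (k>n⇒nCk≡0 (s≤s (s≤s (z≤n {k})))) ⟩
  suc (suc k) ℕ.* 0                  ≡⟨ ℕ.*-zeroʳ (suc (suc k)) ⟩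
  1 ℕ.* 0                            ≡⟨ ≡.cong (1 ℕ.*_) (k>n⇒nCk≡0 (s≤s (z≤n {k}))) ⟨
  1 ℕ.* (0 C suc k)                  ∎
  where open ≡.≡-Reasoning
absorption (suc n) (suc k) = begin
  suc (suc k) ℕ.* (suc (suc n) C suc (suc k))          ≡⟨ ≡.cong (suc (suc k) ℕ.*_) (nCk+nC[k+1]≡[n+1]C[k+1] (suc n) (suc k)) ⟨
  suc (suc k) ℕ.* (a ℕ.+ b)
    ≡⟨ solve 3 (λ k a b → (con 1 :+ k) :* (a :+ b) := a :+ (k :* a :+ (con 1 :+ k) :* b)) ≡.refl (suc k) a b ⟩
  a ℕ.+ (suc k ℕ.* a ℕ.+ suc (suc k) ℕ.* b)            ≡⟨ ≡.cong (a ℕ.+_) (≡.cong₂ ℕ._+_ (absorption n k) (absorption n (suc k))) ⟩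
  a ℕ.+ (suc n ℕ.* (n C k) ℕ.+ suc n ℕ.* (n C suc k))  ≡⟨ ≡.cong (a ℕ.+_) (ℕ.*-distribˡ-+ (suc n) (n C k) (n C suc k)) ⟨
  a ℕ.+ suc n ℕ.* (n C k ℕ.+ n C suc k)                ≡⟨ ≡.cong (λ c → a ℕ.+ suc n ℕ.* c) (nCk+nC[k+1]≡[n+1]C[k+1] n k) ⟩
  suc (suc n) ℕ.* a                                    ∎
  where
  open ≡.≡-Reasoning
  open ℕ-Solver.+-*-Solver
  a = suc n C suc k
  b = suc n C suc (suc k)

-- By `absorption` p divides k · C(p, k), and p cannot divide k because 0 < k < p.
prime∣pCk : ∀ {p k} → Prime p → 0 < k → k < p → p ℕ∣.∣ p C k
prime∣pCk {suc p} {suc k} pr _ (s≤s k<p) with euclidsLemma (suc k) (suc p C suc k) pr (ℕ∣.divides (p C k) (≡.trans (absorption p k) (ℕ.*-comm (suc p) (p C k))))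
... | inj₁ p∣k = contradiction (ℕ∣.∣⇒≤ p∣k) (ℕ.<⇒≱ (s≤s k<p))
... | inj₂ p∣C = p∣C

module Frobenius (R : CommutativeRing 0ℓ 0ℓ) where
  open CommutativeRing R hiding (zero)
  open import Algebra.Properties.Semiring.Exp semiring using (_^_; ^-congˡ; ^-assocʳ)
  open import Algebra.Properties.Semiring.Mult semiring using (×-congʳ; ×-assocˡ; ×-assoc-*; ×-homo-1; ×-congˡ) renaming (_×_ to _·_)
  open import Algebra.Properties.CommutativeSemiring.Binomial commutativeSemiring using (theorem; binomialTerm)
  open import Algebra.Properties.Semiring.Sum semiring using (sum; sum-init-last; sum-cong-≋; sum-replicate-zero)
  open import Relation.Binary.Reasoning.Setoid setoid

  ∣⇒×≈0 : ∀ {p m} → p · 1# ≈ 0# → p ℕ∣.∣ m → ∀ x → m · x ≈ 0#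
  ∣⇒×≈0 {p} p×1≈0 (ℕ∣.divides q ≡.refl) x = begin
    (q ℕ.* p) · x          ≈⟨ ×-congˡ (ℕ.*-comm q p) ⟩
    (p ℕ.* q) · x          ≈⟨ ×-assocˡ x p q ⟨
    p · (q · x)            ≈⟨ ×-congʳ p (*-identityˡ _) ⟨
    p · (1# * (q · x))     ≈⟨ ×-assoc-* p 1# _ ⟨
    (p · 1#) * (q · x)     ≈⟨ *-congʳ p×1≈0 ⟩
    0# * (q · x)           ≈⟨ zeroˡ _ ⟩
    0#                     ∎

  -- In the binomial expansion every term except the two outer ones has a coefficient divisible by
  -- p.
  frobenius : ∀ {p} → Prime p → p · 1# ≈ 0# → ∀ x y → (x + y) ^ p ≈ x ^ p + y ^ p
  frobenius {zero} pr _ x y = contradiction pr λ ()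
  frobenius {p@(suc n)} pr p×1≈0 x y = begin
    (x + y) ^ p                                  ≈⟨ theorem p x y ⟩
    t zero + sum (tail t)                        ≈⟨ +-congˡ (sum-init-last (tail t)) ⟩
    t zero + (sum (init (tail t)) + t (fromℕ p)) ≈⟨ +-cong bottom (+-cong middle top) ⟩
    y ^ p + (0# + x ^ p)                         ≈⟨ +-congˡ (+-identityˡ _) ⟩
    y ^ p + x ^ p                                ≈⟨ +-comm _ _ ⟩
    x ^ p + y ^ p                                ∎
    where
    t = binomialTerm x y p
    bottom : t zero ≈ y ^ p
    bottom = begin
      (p C 0) · (1# * y ^ p) ≈⟨ ×-congˡ (nC0≡1 p) ⟩
      1 · (1# * y ^ p)       ≈⟨ ×-homo-1 _ ⟩
      1# * y ^ p             ≈⟨ *-identityˡ _ ⟩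
      y ^ p                  ∎
    top : t (fromℕ p) ≈ x ^ p
    top = begin
      (p C toℕ (fromℕ p)) · (x ^ toℕ (fromℕ p) * y ^ (p ∸ toℕ (fromℕ p))) ≡⟨ ≡.cong (λ i → (p C i) · (x ^ i * y ^ (p ∸ i))) (Fin.toℕ-fromℕ p) ⟩
      (p C p) · (x ^ p * y ^ (p ∸ p))  ≡⟨ ≡.cong₂ (λ c i → c · (x ^ p * y ^ i)) (nCn≡1 p) (ℕ.n∸n≡0 p) ⟩
      1 · (x ^ p * 1#)                 ≈⟨ ×-homo-1 _ ⟩
      x ^ p * 1#                       ≈⟨ *-identityʳ _ ⟩
      x ^ p                            ∎
    middle : sum (init (tail t)) ≈ 0#
    middle = trans (sum-cong-≋ λ i → ∣⇒×≈0 p×1≈0 (prime∣pCk pr (s≤s z≤n) (s≤s (≡.subst (_< n) (≡.sym (Fin.toℕ-inject₁ i)) (Fin.toℕ<n i)))) _) (sum-replicate-zero n)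

  frobenius-iterate : ∀ {p} → Prime p → p · 1# ≈ 0# → ∀ k x y → (x + y) ^ (p ℕ.^ k) ≈ x ^ (p ℕ.^ k) + y ^ (p ℕ.^ k)
  frobenius-iterate {p} pr p×1≈0 zero x y = trans (*-identityʳ _) (+-cong (sym (*-identityʳ x)) (sym (*-identityʳ y)))
  frobenius-iterate {p} pr p×1≈0 (suc k) x y = begin
    (x + y) ^ (p ℕ.* p ℕ.^ k)                  ≈⟨ ^-assocʳ (x + y) p (p ℕ.^ k) ⟨
    ((x + y) ^ p) ^ (p ℕ.^ k)                  ≈⟨ ^-congˡ (p ℕ.^ k) (frobenius pr p×1≈0 x y) ⟩
    (x ^ p + y ^ p) ^ (p ℕ.^ k)                ≈⟨ frobenius-iterate pr p×1≈0 k (x ^ p) (y ^ p) ⟩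
    (x ^ p) ^ (p ℕ.^ k) + (y ^ p) ^ (p ℕ.^ k)  ≈⟨ +-cong (^-assocʳ x p (p ℕ.^ k)) (^-assocʳ y p (p ℕ.^ k)) ⟩
    x ^ (p ℕ.* p ℕ.^ k) + y ^ (p ℕ.* p ℕ.^ k)  ∎

-- Finite domains

-- If j were missed, punching it out of the codomain would inject n + 1 elements into n.
injective⇒surjective : ∀ {n} (f : Fin n → Fin n) → (∀ {i j} → f i ≡ f j → i ≡ j) → ∀ j → ∃ λ i → f i ≡ j
injective⇒surjective {suc n} f inj j with Fin.any? (λ i → f i Fin.≟ j)
... | yes preimage = preimage
... | no j∉f = contradiction (Fin.injective⇒≤ (λ {i} {i′} → inj ∘ Fin.punchOut-injective (avoids i) (avoids i′))) ℕ.1+n≰n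
  where
  avoids : ∀ i → j ≢ f i
  avoids i eq = j∉f (i , ≡.sym eq)

injective⇒permutation : ∀ {n} (f : Fin n → Fin n) → (∀ {i j} → f i ≡ f j → i ≡ j) → Permutation′ n
injective⇒permutation f inj = permutation f (proj₁ ∘ surj) (proj₂ ∘ surj) (λ i → inj (proj₂ (surj (f i))))
  where surj = injective⇒surjective f inj

-- Finite fields enter as finite domains, so that an instance only has to exclude zero divisors;
-- inverses are recovered in `invertible`. The maps `element` and `index` enumerate the classes of
-- the setoid equality, not the carrier itself.
record FiniteDomain : Set₁ where
  field
    commutativeRing : CommutativeRing 0ℓ 0ℓ
  open CommutativeRing commutativeRing public hiding (zero)
  field
    order         : ℕ
    element       : Fin order → Carrier
    index         : Carrier → Fin order
    index-cong    : ∀ {a b} → a ≈ b → index a ≡ index b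
    element-index : ∀ a → element (index a) ≈ a
    index-element : ∀ i → index (element i) ≡ i
    x*y≈0⇒x≈0∨y≈0 : ∀ {x y} → x * y ≈ 0# → x ≈ 0# ⊎ y ≈ 0#
    1≉0           : ¬ 1# ≈ 0#

module FiniteDomainProperties (D : FiniteDomain) where
  open FiniteDomain D
  open import Algebra.Properties.Ring ring using (x∙y⁻¹≈ε⇒x≈y; [y-z]x≈yx-zx; x≈y⇒x∙y⁻¹≈ε)
  open import Algebra.Properties.Semiring.Exp semiring using (_^_; ^-congʳ; ^-congˡ)
  open import Algebra.Properties.CommutativeMonoid.Sum *-commutativeMonoid
    using (sum-permute; ∑-distrib-+; sum-remove; sum-cong-≋; sum-replicate) renaming (sum to product)
  open import Relation.Binary.Reasoning.Setoid setoid
  open import Algebra.Solver.Ring.NaturalCoefficients.Default commutativeSemiring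

  index-injective : ∀ {a b} → index a ≡ index b → a ≈ b
  index-injective {a} {b} eq = trans (sym (element-index a)) (trans (reflexive (≡.cong element eq)) (element-index b))

  element-injective : ∀ {i j} → element i ≈ element j → i ≡ j
  element-injective {i} {j} eq = ≡.trans (≡.sym (index-element i)) (≡.trans (index-cong eq) (index-element j))

  infix 4 _≈?_
  _≈?_ : ∀ a b → Dec (a ≈ b)
  a ≈? b = map′ index-injective index-cong (index a Fin.≟ index b)

  *-cancelʳ : ∀ {a b} c → ¬ c ≈ 0# → a * c ≈ b * c → a ≈ b
  *-cancelʳ {a} {b} c c≉0 ac≈bc with x*y≈0⇒x≈0∨y≈0 (trans ([y-z]x≈yx-zx c a b) (x≈y⇒x∙y⁻¹≈ε ac≈bc))
  ... | inj₁ a-b≈0 = x∙y⁻¹≈ε⇒x≈y a b a-b≈0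
  ... | inj₂ c≈0   = contradiction c≈0 c≉0

  product≉0 : ∀ {n} (t : Vector Carrier n) → (∀ i → ¬ t i ≈ 0#) → ¬ product t ≈ 0#
  product≉0 {zero}  t t≉0 eq = 1≉0 eq
  product≉0 {suc n} t t≉0 eq with x*y≈0⇒x≈0∨y≈0 eq
  ... | inj₁ h = t≉0 zero h
  ... | inj₂ h = product≉0 (tail t) (t≉0 ∘ suc) h

  -- The extra factor a fills the exceptional slot, so the exponent is n and not a truncated n - 1.
  product-constant-except : ∀ {n} (s : Vector Carrier n) i {a} → s i ≈ 1# → (∀ j → j ≢ i → s j ≈ a) → a * product s ≈ a ^ n
  product-constant-except {suc n} s i {a} sᵢ≈1 s≈a = *-congˡ (begin
    product s                        ≈⟨ sum-remove s ⟩
    s i * product (removeAt s i)     ≈⟨ *-cong sᵢ≈1 (sum-cong-≋ λ j → s≈a (punchIn i j) (Fin.punchInᵢ≢i i j)) ⟩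
    1# * product (replicate n a)     ≈⟨ *-identityˡ _ ⟩
    product (replicate n a)          ≈⟨ sum-replicate n ⟩
    a ^ n                            ∎)

  if-zero : ∀ {a} → Dec (a ≈ 0#) → Carrier → Carrier → Carrier
  if-zero (yes _) x y = x
  if-zero (no _)  x y = y

  private
    -- Multiplication by a ≠ 0 permutes the nonzero elements, so their product t satisfies a^(N-1) t = t.
    module Scaling {a} (a≉0 : ¬ a ≈ 0#) where
      scale : Fin order → Fin order
      scale j = index (a * element j)

      scale-injective : ∀ {i j} → scale i ≡ scale j → i ≡ j
      scale-injective eq = element-injective (*-cancelʳ a a≉0 (trans (*-comm _ _) (trans (index-injective eq) (*-comm _ _))))

      -- The zero element contributes 1 to both products, which lets them range over all of
      -- `Fin order` and be permuted by `scale`.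
      factor unit : Vector Carrier order
      factor j = if-zero (element j ≈? 0#) 1# a
      unit j = if-zero (element j ≈? 0#) 1# (element j)

      unit≉0 : ∀ j → ¬ unit j ≈ 0#
      unit≉0 j with element j ≈? 0#
      ... | yes _ = 1≉0
      ... | no h = h

      unit-scale : ∀ j → unit (scale j) ≈ factor j * unit j
      unit-scale j with element j ≈? 0# | element (scale j) ≈? 0#
      ... | yes _  | yes _  = sym (*-identityʳ 1#)
      ... | no _   | no _   = element-index _
      ... | yes e0 | no e≉0 = contradiction (trans (element-index _) (trans (*-congˡ e0) (zeroʳ a))) e≉0
      ... | no e≉0 | yes e0 with x*y≈0⇒x≈0∨y≈0 (trans (sym (element-index _)) e0)
      ...   | inj₁ h = contradiction h a≉0
      ...   | inj₂ h = contradiction h e≉0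

      scaling : Permutation′ order
      scaling = injective⇒permutation scale scale-injective

      product-factor≈1 : product factor ≈ 1#
      product-factor≈1 = *-cancelʳ (product unit) (product≉0 unit unit≉0) (begin
        product factor * product unit             ≈⟨ ∑-distrib-+ factor unit ⟨
        product (λ j → factor j * unit j)         ≈⟨ sum-cong-≋ unit-scale ⟨
        product (λ j → unit (scaling ⟨$⟩ʳ j))     ≈⟨ sum-permute unit scaling ⟨
        product unit                              ≈⟨ *-identityˡ _ ⟨
        1# * product unit                         ∎)

      factor-zero : factor (index 0#) ≈ 1#
      factor-zero with element (index 0#) ≈? 0#
      ... | yes _ = refl
      ... | no h = contradiction (element-index 0#) h

      factor-nonzero : ∀ j → j ≢ index 0# → factor j ≈ a
      factor-nonzero j j≢0 with element j ≈? 0#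
      ... | yes h = contradiction (≡.trans (≡.sym (index-element j)) (index-cong h)) j≢0
      ... | no _ = refl

      fermat : a ^ order ≈ a
      fermat = begin
        a ^ order           ≈⟨ product-constant-except factor (index 0#) factor-zero factor-nonzero ⟨
        a * product factor  ≈⟨ *-congˡ product-factor≈1 ⟩
        a * 1#              ≈⟨ *-identityʳ a ⟩
        a                   ∎

  0^n≈0 : ∀ n → 0 < n → 0# ^ n ≈ 0#
  0^n≈0 (suc n) _ = zeroˡ _

  order>0 : 0 < order
  order>0 = ℕ.≤-<-trans z≤n (Fin.toℕ<n (index 0#))

  a^order≈a : ∀ a → a ^ order ≈ a
  a^order≈a a with a ≈? 0#
  ... | yes a≈0 = trans (^-congˡ order a≈0) (trans (0^n≈0 order order>0) (sym a≈0))
  ... | no a≉0 = Scaling.fermat a≉0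

  order>1 : 1 < order
  order>1 with order in eq
  ... | zero = contradiction (≡.subst (0 <_) eq order>0) λ ()
  ... | suc (suc _) = s≤s (s≤s z≤n)
  ... | suc zero = contradiction (index-injective (sameIndex order eq (index 1#) (index 0#))) 1≉0
    where
    sameIndex : ∀ n → n ≡ 1 → (i j : Fin n) → i ≡ j
    sameIndex _ ≡.refl zero zero = ≡.refl

  -- The inverse is a^(order - 2): cancel one a in a^order = a.
  invertible : ∀ {a} → ¬ a ≈ 0# → ∃ λ b → b * a ≈ 1#
  invertible {a} a≉0 with order in eq | order>1
  ... | suc zero | s≤s ()
  ... | suc (suc n) | _ = a ^ n , *-cancelʳ a a≉0 (begin
    (a ^ n * a) * a  ≈⟨ solve 2 (λ a b → (b :* a) :* a := a :* (a :* b)) refl a (a ^ n) ⟩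
    a ^ suc (suc n)  ≈⟨ ^-congʳ a eq ⟨
    a ^ order        ≈⟨ a^order≈a a ⟩
    a                ≈⟨ *-identityˡ a ⟨
    1# * a           ∎)

  -- The vector lists the lower coefficients of a monic polynomial whose leading coefficient 1 is
  -- implicit, so its length is the exact degree.
  eval : ∀ {n} → Vec Carrier n → Carrier → Carrier
  eval []      b = 1#
  eval (c ∷ p) b = c + b * eval p b

  -- Synthetic division by X - a; the remainder, which is the value at a, is dropped.
  divideByRoot : ∀ {n} → Vec Carrier (suc n) → Carrier → Vec Carrier n
  divideByRoot (c ∷ []) a = []
  divideByRoot (c ∷ p@(_ ∷ _)) a = eval p a ∷ divideByRoot p a

  -- p(b) - p(a) = (b - a) q(b), with both sides moved so that no subtraction occurs.
  eval-divideByRoot : ∀ {n} (p : Vec Carrier (suc n)) a b →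
    eval p b + a * eval (divideByRoot p a) b ≈ eval p a + b * eval (divideByRoot p a) b
  eval-divideByRoot (c ∷ []) a b =
    solve 3 (λ c a b → (c :+ b :* con 1) :+ a :* con 1 := (c :+ a :* con 1) :+ b :* con 1) refl c a b
  eval-divideByRoot (c ∷ p@(_ ∷ _)) a b = begin
    (c + b * pb) + a * (pa + b * qb)
      ≈⟨ solve 6 (λ c a b pa pb qb → (c :+ b :* pb) :+ a :* (pa :+ b :* qb) := c :+ a :* pa :+ b :* (pb :+ a :* qb)) refl c a b pa pb qb ⟩
    c + a * pa + b * (pb + a * qb)    ≈⟨ +-congˡ (*-congˡ (eval-divideByRoot p a b)) ⟩
    c + a * pa + b * (pa + b * qb)    ∎
    where
    pa = eval p a
    pb = eval p b
    qb = eval (divideByRoot p a) b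

  -- Divide by X - a for the first root a. At any other root b the quotient vanishes, since
  -- otherwise it could be cancelled from a q(b) = b q(b).
  roots≤degree : ∀ {n m} (p : Vec Carrier n) (ρ : Fin m → Carrier) →
    (∀ {i j} → ρ i ≈ ρ j → i ≡ j) → (∀ i → eval p (ρ i) ≈ 0#) → m ≤ n
  roots≤degree {m = zero} p ρ inj root = z≤n
  roots≤degree {zero} {suc m} [] ρ inj root = contradiction (root zero) 1≉0
  roots≤degree {suc n} {suc m} p ρ inj root = s≤s (roots≤degree (divideByRoot p a) (ρ ∘ suc) (Fin.suc-injective ∘ inj) root′)
    where
    a = ρ zero
    root′ : ∀ i → eval (divideByRoot p a) (ρ (suc i)) ≈ 0#
    root′ i with eval (divideByRoot p a) (ρ (suc i)) ≈? 0#
    ... | yes q≈0 = q≈0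
    ... | no q≉0 = contradiction (inj (*-cancelʳ _ q≉0 (begin
      a * q             ≈⟨ +-identityˡ _ ⟨
      0# + a * q        ≈⟨ +-congʳ (root (suc i)) ⟨
      eval p b + a * q  ≈⟨ eval-divideByRoot p a b ⟩
      eval p a + b * q  ≈⟨ +-congʳ (root zero) ⟩
      0# + b * q        ≈⟨ +-identityˡ _ ⟩
      b * q             ∎))) λ ()
      where
      b = ρ (suc i)
      q = eval (divideByRoot p a) b

  eval-zeros : ∀ n b → eval (Vec.replicate n 0#) b ≈ b ^ n
  eval-zeros zero b = refl
  eval-zeros (suc n) b = trans (+-identityˡ _) (*-congˡ (eval-zeros n b))

  -- The identity x^n = x says that every element is a root of a monic polynomial of degree n.
  order≤exponent : ∀ {n} → 1 < n → (∀ a → a ^ n ≈ a) → order ≤ n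
  order≤exponent {suc (suc n)} _ a^n≈a = roots≤degree (0# ∷ - 1# ∷ Vec.replicate n 0#) element element-injective root
    where
    open import Algebra.Properties.Ring ring using (-‿distribʳ-*)
    root : ∀ i → 0# + element i * (- 1# + element i * eval (Vec.replicate n 0#) (element i)) ≈ 0#
    root i = begin
      0# + a * (- 1# + a * eval (Vec.replicate n 0#) a)  ≈⟨ +-identityˡ _ ⟩
      a * (- 1# + a * eval (Vec.replicate n 0#) a)       ≈⟨ distribˡ a _ _ ⟩
      a * - 1# + a * (a * eval (Vec.replicate n 0#) a)   ≈⟨ +-cong (sym (-‿distribʳ-* a 1#)) (*-congˡ (*-congˡ (eval-zeros n a))) ⟩
      - (a * 1#) + a ^ suc (suc n)                       ≈⟨ +-cong (-‿cong (*-identityʳ a)) (a^n≈a a) ⟩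
      - a + a                                            ≈⟨ -‿inverseˡ a ⟩
      0#                                                 ∎
      where a = element i
  order≤exponent {suc zero} (s≤s ()) _

-- The integers modulo a prime

module IntegersModPrime {p} (pr : Prime p) where
  open import Data.Integer using (+_)
  open Quotient ℤ.+-*-commutativeRing (+ p) using (_~_; quotientRing) renaming (_,_ to _⸴_)
  open import Data.Integer.Divisibility.Signed using (∣ᵤ⇒∣; divides)
  open CommutativeRing quotientRing using (sym; trans)
  open import Algebra.Properties.Semiring.Mult (CommutativeRing.semiring quotientRing) renaming (_×_ to _·_)

  instance
    p≢0 : ℕ.NonZero p
    p≢0 = ℕ.nonTrivial⇒nonZero p {{prime⇒nonTrivial pr}}

  -- The two residues differ by less than p in absolute value, which forces the multiplier q to be
  -- 0.
  ~⇒≡ : ∀ {r s} → r < p → s < p → + r ~ + s → r ≡ s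
  ~⇒≡ {r} {s} r<p s<p (q ⸴ eq) = ℤ.+-injective (≡.trans eq
    (≡.trans (≡.cong (λ q → + s ℤ.+ q ℤ.* + p) (ℤ.∣i∣≡0⇒i≡0 {q} (∣q∣≡0 ℤ.∣ q ∣ small))) (ℤ.+-identityʳ (+ s))))
    where
    open ℕ.≤-Reasoning
    r⊖s≡qp : r ℤ.⊖ s ≡ q ℤ.* + p
    r⊖s≡qp = ≡.trans (≡.sym (ℤ.m-n≡m⊖n r s)) (≡.trans (≡.cong (ℤ._- + s) (≡.trans eq (ℤ.+-comm (+ s) (q ℤ.* + p))))
      (≡.trans (ℤ.+-assoc (q ℤ.* + p) (+ s) (ℤ.- + s)) (≡.trans (≡.cong (λ z → q ℤ.* + p ℤ.+ z) (ℤ.+-inverseʳ (+ s))) (ℤ.+-identityʳ _))))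
    small : ℤ.∣ q ∣ ℕ.* p < p
    small = begin-strict
      ℤ.∣ q ∣ ℕ.* p      ≡⟨ ℤ.abs-* q (+ p) ⟨
      ℤ.∣ q ℤ.* + p ∣    ≡⟨ ≡.cong ℤ.∣_∣ r⊖s≡qp ⟨
      ℤ.∣ r ℤ.⊖ s ∣      ≤⟨ ℤ.∣m⊝n∣≤m⊔n r s ⟩
      r ℕ.⊔ s            <⟨ ℕ.⊔-lub r<p s<p ⟩
      p                  ∎
    ∣q∣≡0 : ∀ m → m ℕ.* p < p → m ≡ 0
    ∣q∣≡0 zero _ = ≡.refl
    ∣q∣≡0 (suc m) h = contradiction (ℕ.m≤m+n p (m ℕ.* p)) (ℕ.<⇒≱ h)

  ~0⇒∣ : ∀ {x} → x ~ + 0 → p ℕ∣.∣ ℤ.∣ x ∣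
  ~0⇒∣ (q ⸴ eq) = ℕ∣.divides ℤ.∣ q ∣ (≡.trans (≡.cong ℤ.∣_∣ (≡.trans eq (ℤ.+-identityˡ (q ℤ.* + p)))) (ℤ.abs-* q (+ p)))

  ∣⇒~0 : ∀ {x} → p ℕ∣.∣ ℤ.∣ x ∣ → x ~ + 0
  ∣⇒~0 {x} p∣x with ∣ᵤ⇒∣ {+ p} {x} p∣x
  ... | divides q eq = q ⸴ ≡.trans eq (≡.sym (ℤ.+-identityˡ (q ℤ.* + p)))

  mod-~ : ∀ a → + (a ℤ.%ℕ p) ~ a
  mod-~ a = sym ((a ℤ./ℕ p) ⸴ ℤ.a≡a%ℕn+[a/ℕn]*n a p)

  modPrime : FiniteDomain
  modPrime = record
    { commutativeRing = quotientRing
    ; order = p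
    ; element = λ i → + toℕ i
    ; index = λ a → Fin.fromℕ< (ℤ.n%ℕd<d a p)
    ; index-cong = λ {a} {b} a~b → Fin.fromℕ<-cong _ _ (~⇒≡ (ℤ.n%ℕd<d a p) (ℤ.n%ℕd<d b p) (trans (mod-~ a) (trans a~b (sym (mod-~ b))))) _ _
    ; element-index = λ a → ≡.subst (λ r → + r ~ a) (≡.sym (Fin.toℕ-fromℕ< _)) (mod-~ a)
    ; index-element = λ i → Fin.toℕ-injective (≡.trans (Fin.toℕ-fromℕ< _) (~⇒≡ (ℤ.n%ℕd<d (+ toℕ i) p) (Fin.toℕ<n i) (mod-~ (+ toℕ i))))
    ; x*y≈0⇒x≈0∨y≈0 = λ {x} {y} xy~0 → Sum.map ∣⇒~0 ∣⇒~0 (euclidsLemma ℤ.∣ x ∣ ℤ.∣ y ∣ pr (≡.subst (p ℕ∣.∣_) (ℤ.abs-* x y) (~0⇒∣ xy~0)))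
    ; 1≉0 = λ 1~0 → contradiction (ℕ∣.∣⇒≤ (~0⇒∣ 1~0)) (ℕ.<⇒≱ (ℕ.nonTrivial⇒n>1 p {{prime⇒nonTrivial pr}}))
    }

  open FiniteDomain modPrime using (_≈_; 0#; 1#)

  n·1≡n : ∀ n → n · 1# ≡ + n
  n·1≡n zero = ≡.refl
  n·1≡n (suc n) = ≡.cong (λ z → + 1 ℤ.+ z) (n·1≡n n)

  p·1≈0 : p · 1# ≈ 0#
  p·1≈0 = ∣⇒~0 (≡.subst (λ x → p ℕ∣.∣ ℤ.∣ x ∣) (≡.sym (n·1≡n p)) ℕ∣.∣-refl)

-- Polynomials

module Polynomials (R : CommutativeRing 0ℓ 0ℓ) where
  open CommutativeRing R hiding (zero)
  open import Algebra.Properties.Ring ring using (-0#≈0#)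
  open import Algebra.Solver.Ring.NaturalCoefficients.Default commutativeSemiring using (solve; _:=_; _:+_)
  open import Relation.Binary.Reasoning.Setoid setoid

  -- Coefficients in increasing degree; trailing zeros are identified by _≋_.
  Polynomial : Set
  Polynomial = List Carrier

  coeff : Polynomial → ℕ → Carrier
  coeff []      _       = 0#
  coeff (a ∷ p) zero    = a
  coeff (a ∷ p) (suc i) = coeff p i

  infix 4 _≋_
  record _≋_ (p q : Polynomial) : Set where
    constructor pointwise
    field at : ∀ i → coeff p i ≈ coeff q i
  open _≋_ public

  infixl 6 _⊕_
  infixl 7 _⊗_ _⊙_

  _⊕_ : Polynomial → Polynomial → Polynomial
  []      ⊕ q       = q
  (a ∷ p) ⊕ []      = a ∷ p
  (a ∷ p) ⊕ (b ∷ q) = a + b ∷ p ⊕ q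

  _⊙_ : Carrier → Polynomial → Polynomial
  a ⊙ p = List.map (a *_) p

  ⊖_ : Polynomial → Polynomial
  ⊖ p = List.map -_ p

  _⊗_ : Polynomial → Polynomial → Polynomial
  []      ⊗ q = []
  (a ∷ p) ⊗ q = a ⊙ q ⊕ (0# ∷ p ⊗ q)

  coeff-⊕ : ∀ p q i → coeff (p ⊕ q) i ≈ coeff p i + coeff q i
  coeff-⊕ []      q       i       = sym (+-identityˡ _)
  coeff-⊕ (a ∷ p) []      i       = sym (+-identityʳ _)
  coeff-⊕ (a ∷ p) (b ∷ q) zero    = refl
  coeff-⊕ (a ∷ p) (b ∷ q) (suc i) = coeff-⊕ p q i

  coeff-⊙ : ∀ a p i → coeff (a ⊙ p) i ≈ a * coeff p i
  coeff-⊙ a []      i       = sym (zeroʳ a)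
  coeff-⊙ a (b ∷ p) zero    = refl
  coeff-⊙ a (b ∷ p) (suc i) = coeff-⊙ a p i

  coeff-⊖ : ∀ p i → coeff (⊖ p) i ≈ - coeff p i
  coeff-⊖ []      i       = sym -0#≈0#
  coeff-⊖ (b ∷ p) zero    = refl
  coeff-⊖ (b ∷ p) (suc i) = coeff-⊖ p i

  ≋-refl : ∀ {p} → p ≋ p
  ≋-refl .at i = refl

  ≋-sym : ∀ {p q} → p ≋ q → q ≋ p
  ≋-sym p≋q .at i = sym (at p≋q i)

  ≋-trans : ∀ {p q r} → p ≋ q → q ≋ r → p ≋ r
  ≋-trans p≋q q≋r .at i = trans (at p≋q i) (at q≋r i)

  ∷-cong : ∀ {a b p q} → a ≈ b → p ≋ q → a ∷ p ≋ b ∷ q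
  ∷-cong a≈b p≋q .at zero    = a≈b
  ∷-cong a≈b p≋q .at (suc i) = at p≋q i

  0∷[]≋[] : 0# ∷ [] ≋ []
  0∷[]≋[] .at zero    = refl
  0∷[]≋[] .at (suc i) = refl

  ⊕-cong : ∀ {p p′ q q′} → p ≋ p′ → q ≋ q′ → p ⊕ q ≋ p′ ⊕ q′
  ⊕-cong {p} {p′} {q} {q′} p≋p′ q≋q′ .at i =
    trans (coeff-⊕ p q i) (trans (+-cong (at p≋p′ i) (at q≋q′ i)) (sym (coeff-⊕ p′ q′ i)))

  ⊕-assoc : ∀ p q r → (p ⊕ q) ⊕ r ≋ p ⊕ (q ⊕ r)
  ⊕-assoc p q r .at i = begin
    coeff ((p ⊕ q) ⊕ r) i                  ≈⟨ trans (coeff-⊕ (p ⊕ q) r i) (+-congʳ (coeff-⊕ p q i)) ⟩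
    (coeff p i + coeff q i) + coeff r i    ≈⟨ +-assoc _ _ _ ⟩
    coeff p i + (coeff q i + coeff r i)    ≈⟨ trans (coeff-⊕ p (q ⊕ r) i) (+-congˡ (coeff-⊕ q r i)) ⟨
    coeff (p ⊕ (q ⊕ r)) i                  ∎

  ⊕-comm : ∀ p q → p ⊕ q ≋ q ⊕ p
  ⊕-comm p q .at i = trans (coeff-⊕ p q i) (trans (+-comm _ _) (sym (coeff-⊕ q p i)))

  ⊕-identityʳ : ∀ p → p ⊕ [] ≋ p
  ⊕-identityʳ p .at i = trans (coeff-⊕ p [] i) (+-identityʳ _)

  ⊕-inverseʳ : ∀ p → p ⊕ ⊖ p ≋ []
  ⊕-inverseʳ p .at i = trans (coeff-⊕ p (⊖ p) i) (trans (+-congˡ (coeff-⊖ p i)) (-‿inverseʳ _))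

  ⊖-cong : ∀ {p q} → p ≋ q → ⊖ p ≋ ⊖ q
  ⊖-cong {p} {q} p≋q .at i = trans (coeff-⊖ p i) (trans (-‿cong (at p≋q i)) (sym (coeff-⊖ q i)))

  ⊙-cong : ∀ {a b p q} → a ≈ b → p ≋ q → a ⊙ p ≋ b ⊙ q
  ⊙-cong {a} {b} {p} {q} a≈b p≋q .at i = trans (coeff-⊙ a p i) (trans (*-cong a≈b (at p≋q i)) (sym (coeff-⊙ b q i)))

  ⊙-identity : ∀ p → 1# ⊙ p ≋ p
  ⊙-identity p .at i = trans (coeff-⊙ 1# p i) (*-identityˡ _)

  ⊙-zero : ∀ p → 0# ⊙ p ≋ []
  ⊙-zero p .at i = trans (coeff-⊙ 0# p i) (zeroˡ _)

  ⊙-assoc : ∀ a b p → (a * b) ⊙ p ≋ a ⊙ (b ⊙ p)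
  ⊙-assoc a b p .at i = begin
    coeff ((a * b) ⊙ p) i    ≈⟨ coeff-⊙ (a * b) p i ⟩
    (a * b) * coeff p i      ≈⟨ *-assoc a b _ ⟩
    a * (b * coeff p i)      ≈⟨ trans (coeff-⊙ a (b ⊙ p) i) (*-congˡ (coeff-⊙ b p i)) ⟨
    coeff (a ⊙ (b ⊙ p)) i    ∎

  ⊙-distribˡ : ∀ a p q → a ⊙ (p ⊕ q) ≋ a ⊙ p ⊕ a ⊙ q
  ⊙-distribˡ a p q .at i = begin
    coeff (a ⊙ (p ⊕ q)) i              ≈⟨ trans (coeff-⊙ a (p ⊕ q) i) (*-congˡ (coeff-⊕ p q i)) ⟩
    a * (coeff p i + coeff q i)        ≈⟨ distribˡ a _ _ ⟩
    a * coeff p i + a * coeff q i      ≈⟨ trans (coeff-⊕ (a ⊙ p) (a ⊙ q) i) (+-cong (coeff-⊙ a p i) (coeff-⊙ a q i)) ⟨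
    coeff (a ⊙ p ⊕ a ⊙ q) i            ∎

  ⊙-distribʳ : ∀ a b p → (a + b) ⊙ p ≋ a ⊙ p ⊕ b ⊙ p
  ⊙-distribʳ a b p .at i = begin
    coeff ((a + b) ⊙ p) i              ≈⟨ coeff-⊙ (a + b) p i ⟩
    (a + b) * coeff p i                ≈⟨ distribʳ _ a b ⟩
    a * coeff p i + b * coeff p i      ≈⟨ trans (coeff-⊕ (a ⊙ p) (b ⊙ p) i) (+-cong (coeff-⊙ a p i) (coeff-⊙ b p i)) ⟨
    coeff (a ⊙ p ⊕ b ⊙ p) i            ∎

  ⊕-interchange : ∀ p q r s → (p ⊕ q) ⊕ (r ⊕ s) ≋ (p ⊕ r) ⊕ (q ⊕ s)
  ⊕-interchange p q r s .at i = begin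
    coeff ((p ⊕ q) ⊕ (r ⊕ s)) i  ≈⟨ expand p q r s ⟩
    (coeff p i + coeff q i) + (coeff r i + coeff s i)
      ≈⟨ solve 4 (λ a b c d → (a :+ b) :+ (c :+ d) := (a :+ c) :+ (b :+ d)) refl (coeff p i) (coeff q i) (coeff r i) (coeff s i) ⟩
    (coeff p i + coeff r i) + (coeff q i + coeff s i)  ≈⟨ expand p r q s ⟨
    coeff ((p ⊕ r) ⊕ (q ⊕ s)) i  ∎
    where
    expand : ∀ p q r s → coeff ((p ⊕ q) ⊕ (r ⊕ s)) i ≈ (coeff p i + coeff q i) + (coeff r i + coeff s i)
    expand p q r s = trans (coeff-⊕ (p ⊕ q) (r ⊕ s) i) (+-cong (coeff-⊕ p q i) (coeff-⊕ r s i))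

  0∷-⊕ : ∀ p q → 0# ∷ (p ⊕ q) ≋ (0# ∷ p) ⊕ (0# ∷ q)
  0∷-⊕ p q = ∷-cong (sym (+-identityˡ 0#)) ≋-refl

  ⊗-congˡ : ∀ p {q q′} → q ≋ q′ → p ⊗ q ≋ p ⊗ q′
  ⊗-congˡ []      q≋q′ = ≋-refl
  ⊗-congˡ (a ∷ p) q≋q′ = ⊕-cong (⊙-cong refl q≋q′) (∷-cong refl (⊗-congˡ p q≋q′))

  -- The zero polynomial may be represented by a nonempty list of zeros; `⊗-congʳ` needs this when
  -- its two lists have different lengths.
  ⊗-zeroˡ : ∀ p {q} → p ≋ [] → p ⊗ q ≋ []
  ⊗-zeroˡ []      p≋0 = ≋-refl
  ⊗-zeroˡ (a ∷ p) {q} p≋0 = ⊕-cong (≋-trans (⊙-cong (at p≋0 zero) ≋-refl) (⊙-zero q))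
    (≋-trans (∷-cong refl (⊗-zeroˡ p (pointwise (at p≋0 ∘ suc)))) 0∷[]≋[])

  ⊗-congʳ : ∀ p p′ {q} → p ≋ p′ → p ⊗ q ≋ p′ ⊗ q
  ⊗-congʳ []      p′        p≋p′ = ≋-sym (⊗-zeroˡ p′ (≋-sym p≋p′))
  ⊗-congʳ (a ∷ p) []        p≋p′ = ⊗-zeroˡ (a ∷ p) p≋p′
  ⊗-congʳ (a ∷ p) (b ∷ p′) p≋p′ = ⊕-cong (⊙-cong (at p≋p′ zero) ≋-refl) (∷-cong refl (⊗-congʳ p p′ (pointwise (at p≋p′ ∘ suc))))

  ⊗-distribʳ : ∀ r p q → (p ⊕ q) ⊗ r ≋ p ⊗ r ⊕ q ⊗ r
  ⊗-distribʳ r []      q       = ≋-refl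
  ⊗-distribʳ r (a ∷ p) []      = ≋-sym (⊕-identityʳ _)
  ⊗-distribʳ r (a ∷ p) (b ∷ q) = ≋-trans
    (⊕-cong (⊙-distribʳ a b r) (≋-trans (∷-cong refl (⊗-distribʳ r p q)) (0∷-⊕ (p ⊗ r) (q ⊗ r))))
    (⊕-interchange (a ⊙ r) (b ⊙ r) (0# ∷ p ⊗ r) (0# ∷ q ⊗ r))

  ⊗-zeroʳ : ∀ p → p ⊗ [] ≋ []
  ⊗-zeroʳ []      = ≋-refl
  ⊗-zeroʳ (a ∷ p) = ≋-trans (∷-cong refl (⊗-zeroʳ p)) 0∷[]≋[]

  -- The mirror image of the defining recursion of `_⊗_`, which turns commutativity into a plain
  -- induction.
  ⊗-∷ʳ : ∀ p b q → p ⊗ (b ∷ q) ≋ b ⊙ p ⊕ (0# ∷ p ⊗ q)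
  ⊗-∷ʳ []      b q = ≋-sym 0∷[]≋[]
  ⊗-∷ʳ (a ∷ p) b q = ∷-cong (+-congʳ (*-comm a b)) (≋-trans (⊕-cong (≋-refl {a ⊙ q}) (⊗-∷ʳ p b q))
    (≋-trans (≋-sym (⊕-assoc (a ⊙ q) (b ⊙ p) _)) (≋-trans (⊕-cong (⊕-comm (a ⊙ q) (b ⊙ p)) ≋-refl) (⊕-assoc (b ⊙ p) (a ⊙ q) _))))

  ⊗-comm : ∀ p q → p ⊗ q ≋ q ⊗ p
  ⊗-comm []      q = ≋-sym (⊗-zeroʳ q)
  ⊗-comm (a ∷ p) q = ≋-trans (⊕-cong (≋-refl {a ⊙ q}) (∷-cong refl (⊗-comm p q))) (≋-sym (⊗-∷ʳ q a p))

  ⊗-distribˡ : ∀ p q r → p ⊗ (q ⊕ r) ≋ p ⊗ q ⊕ p ⊗ r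
  ⊗-distribˡ p q r = ≋-trans (⊗-comm p (q ⊕ r)) (≋-trans (⊗-distribʳ p q r) (⊕-cong (⊗-comm q p) (⊗-comm r p)))

  ⊙-⊗ : ∀ a p q → (a ⊙ p) ⊗ q ≋ a ⊙ (p ⊗ q)
  ⊙-⊗ a []      q = ≋-refl
  ⊙-⊗ a (b ∷ p) q = ≋-trans
    (⊕-cong (⊙-assoc a b q) (∷-cong (sym (zeroʳ a)) (⊙-⊗ a p q)))
    (≋-sym (⊙-distribˡ a (b ⊙ q) (0# ∷ p ⊗ q)))

  0∷-⊗ : ∀ p q → (0# ∷ p) ⊗ q ≋ 0# ∷ p ⊗ q
  0∷-⊗ p q = ⊕-cong (⊙-zero q) (≋-refl {0# ∷ p ⊗ q})

  ⊗-assoc : ∀ p q r → (p ⊗ q) ⊗ r ≋ p ⊗ (q ⊗ r)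
  ⊗-assoc []      q r = ≋-refl
  ⊗-assoc (a ∷ p) q r = ≋-trans (⊗-distribʳ r (a ⊙ q) (0# ∷ p ⊗ q))
    (⊕-cong (⊙-⊗ a q r) (≋-trans (0∷-⊗ (p ⊗ q) r) (∷-cong refl (⊗-assoc p q r))))

  one : Polynomial
  one = 1# ∷ []

  const⊗ : ∀ a p → (a ∷ []) ⊗ p ≋ a ⊙ p
  const⊗ a p = ≋-trans (⊕-cong (≋-refl {a ⊙ p}) 0∷[]≋[]) (⊕-identityʳ (a ⊙ p))

  ⊗-identityˡ : ∀ p → one ⊗ p ≋ p
  ⊗-identityˡ p = ≋-trans (const⊗ 1# p) (⊙-identity p)

  polynomialRing : CommutativeRing 0ℓ 0ℓ
  polynomialRing = record
    { Carrier = Polynomial ; _≈_ = _≋_ ; _+_ = _⊕_ ; _*_ = _⊗_ ; -_ = ⊖_ ; 0# = [] ; 1# = one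
    ; isCommutativeRing = record
      { isRing = record
        { +-isAbelianGroup = record
          { isGroup = record
            { isMonoid = record
              { isSemigroup = record
                { isMagma = record
                  { isEquivalence = record { refl = ≋-refl ; sym = ≋-sym ; trans = ≋-trans }
                  ; ∙-cong = ⊕-cong }
                ; assoc = ⊕-assoc }
              ; identity = (λ p → ≋-refl) , ⊕-identityʳ }
            ; inverse = (λ p → ≋-trans (⊕-comm (⊖ p) p) (⊕-inverseʳ p)) , ⊕-inverseʳ
            ; ⁻¹-cong = ⊖-cong }
          ; comm = ⊕-comm }
        ; *-cong = λ {p} {p′} {q} {q′} p≋p′ q≋q′ → ≋-trans (⊗-congʳ p p′ p≋p′) (⊗-congˡ p′ q≋q′)
        ; *-assoc = ⊗-assoc
        ; *-identity = ⊗-identityˡ , λ p → ≋-trans (⊗-comm p one) (⊗-identityˡ p)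
        ; distrib = ⊗-distribˡ , ⊗-distribʳ }
      ; *-comm = ⊗-comm } }

  X : Polynomial
  X = 0# ∷ 1# ∷ []

  -- Horner form, the induction step of `power~self`.
  ∷≋const+X⊗ : ∀ a p → a ∷ p ≋ (a ∷ []) ⊕ X ⊗ p
  ∷≋const+X⊗ a p = ≋-trans (∷-cong (sym (+-identityʳ a)) ≋-refl)
    (⊕-cong (≋-refl {a ∷ []}) (≋-sym (≋-trans (0∷-⊗ one p) (∷-cong refl (⊗-identityˡ p)))))

  -- Degree less than d, with zero below every d. As a predicate it avoids deciding which trailing
  -- coefficients vanish.
  Below : Polynomial → ℕ → Set
  Below p d = ∀ i → d ≤ i → coeff p i ≈ 0#

  Below-resp : ∀ {p q d} → p ≋ q → Below p d → Below q d
  Below-resp p≋q p<d i d≤i = trans (sym (at p≋q i)) (p<d i d≤i)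

  Below-mono : ∀ {p d e} → d ≤ e → Below p d → Below p e
  Below-mono d≤e p<d i e≤i = p<d i (ℕ.≤-trans d≤e e≤i)

  Below-⊕ : ∀ {p q d} → Below p d → Below q d → Below (p ⊕ q) d
  Below-⊕ {p} {q} p<d q<d i d≤i = trans (coeff-⊕ p q i) (trans (+-cong (p<d i d≤i) (q<d i d≤i)) (+-identityˡ 0#))

  Below-⊖ : ∀ {p d} → Below p d → Below (⊖ p) d
  Below-⊖ {p} p<d i d≤i = trans (coeff-⊖ p i) (trans (-‿cong (p<d i d≤i)) -0#≈0#)

  Below-⊙ : ∀ a {p d} → Below p d → Below (a ⊙ p) d
  Below-⊙ a {p} p<d i d≤i = trans (coeff-⊙ a p i) (trans (*-congˡ (p<d i d≤i)) (zeroʳ a))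

  Below-suc : ∀ p {d} → Below p (suc d) → coeff p d ≈ 0# → Below p d
  Below-suc p p≤d c≈0 i d≤i with ℕ.m≤n⇒m<n∨m≡n d≤i
  ... | inj₁ d<i    = p≤d i d<i
  ... | inj₂ ≡.refl = c≈0

  Below-0 : ∀ {p} → Below p 0 → p ≋ []
  Below-0 p<0 .at i = p<0 i z≤n

  Below-length : ∀ p → Below p (List.length p)
  Below-length []      i       _         = refl
  Below-length (a ∷ p) (suc i) (s≤s p≤i) = Below-length p i p≤i

  Below-⊗ : ∀ p q {m n} → Below p (suc m) → Below q (suc n) → Below (p ⊗ q) (suc (m ℕ.+ n))
  Below-⊗ [] q p≤m q≤n i _ = refl
  Below-⊗ (a ∷ p) q {m} {n} p≤m q≤n (suc i) (s≤s m+n≤i) = begin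
    coeff (a ⊙ q ⊕ (0# ∷ p ⊗ q)) (suc i)      ≈⟨ coeff-⊕ (a ⊙ q) _ (suc i) ⟩
    coeff (a ⊙ q) (suc i) + coeff (p ⊗ q) i   ≈⟨ +-cong (Below-⊙ a {q} q≤n (suc i) (s≤s (ℕ.≤-trans (ℕ.m≤n+m n m) m+n≤i))) (remaining m p≤m m+n≤i) ⟩
    0# + 0#                                   ≈⟨ +-identityˡ 0# ⟩
    0#                                        ∎
    where
    remaining : ∀ m → Below (a ∷ p) (suc m) → m ℕ.+ n ≤ i → coeff (p ⊗ q) i ≈ 0#
    -- In degree 0 the tail is zero as a polynomial, though it need not be the empty list.
    remaining zero    p≤0 _     = at (⊗-zeroˡ p (pointwise λ j → p≤0 (suc j) (s≤s z≤n))) i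
    remaining (suc m) p≤m m+n≤i = Below-⊗ p q (λ j m<j → p≤m (suc j) (s≤s m<j)) q≤n i m+n≤i

  coeff-⊗-top : ∀ p q {m n} → Below p (suc m) → Below q (suc n) → coeff (p ⊗ q) (m ℕ.+ n) ≈ coeff p m * coeff q n
  coeff-⊗-top [] q p≤m q≤n = sym (zeroˡ _)
  coeff-⊗-top (a ∷ p) q {zero} {n} p≤0 q≤n = begin
    coeff (a ⊙ q ⊕ (0# ∷ p ⊗ q)) n              ≈⟨ coeff-⊕ (a ⊙ q) _ n ⟩
    coeff (a ⊙ q) n + coeff (0# ∷ p ⊗ q) n
      ≈⟨ +-cong (coeff-⊙ a q n) (at (≋-trans (∷-cong refl (⊗-zeroˡ p (pointwise λ j → p≤0 (suc j) (s≤s z≤n)))) 0∷[]≋[]) n) ⟩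
    a * coeff q n + 0#                          ≈⟨ +-identityʳ _ ⟩
    a * coeff q n                               ∎
  coeff-⊗-top (a ∷ p) q {suc m} {n} p≤m q≤n = begin
    coeff (a ⊙ q ⊕ (0# ∷ p ⊗ q)) (suc (m ℕ.+ n))            ≈⟨ coeff-⊕ (a ⊙ q) _ (suc (m ℕ.+ n)) ⟩
    coeff (a ⊙ q) (suc (m ℕ.+ n)) + coeff (p ⊗ q) (m ℕ.+ n)
      ≈⟨ +-cong (Below-⊙ a {q} q≤n _ (s≤s (ℕ.m≤n+m n m))) (coeff-⊗-top p q (λ j m<j → p≤m (suc j) (s≤s m<j)) q≤n) ⟩
    0# + coeff p m * coeff q n                              ≈⟨ +-identityˡ _ ⟩
    coeff p m * coeff q n                                   ∎

  record Monic (p : Polynomial) (d : ℕ) : Set where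
    constructor monic
    field
      leading : coeff p d ≈ 1#
      bounded : Below p (suc d)
  open Monic public

  Monic-one : Monic one 0
  Monic-one = monic refl λ { (suc i) _ → refl }

  Monic-X : Monic X 1
  Monic-X = monic refl λ { (suc (suc i)) _ → refl ; (suc zero) (s≤s ()) }

  Monic-⊗ : ∀ {p q m n} → Monic p m → Monic q n → Monic (p ⊗ q) (m ℕ.+ n)
  Monic-⊗ {p} {q} (monic l b) (monic l′ b′) =
    monic (trans (coeff-⊗-top p q b b′) (trans (*-cong l l′) (*-identityˡ 1#))) (Below-⊗ p q b b′)

  Monic-⊕ : ∀ {p q d} → Monic p d → Below q d → Monic (p ⊕ q) d
  Monic-⊕ {p} {q} {d} (monic l b) q<d =
    monic (trans (coeff-⊕ p q d) (trans (+-cong l (q<d d ℕ.≤-refl)) (+-identityʳ 1#))) (Below-⊕ {p} {q} b (Below-mono {q} (ℕ.n≤1+n d) q<d))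

  open import Algebra.Properties.Semiring.Exp (CommutativeRing.semiring polynomialRing) using (_^_) public

  Monic-X^ : ∀ n → Monic (X ^ n) n
  Monic-X^ zero    = Monic-one
  Monic-X^ (suc n) = Monic-⊗ Monic-X (Monic-X^ n)

  -- Divide the tail first. Prepending c to its remainder gives degree at most d, and subtracting t
  -- times f, with t the coefficient at d, brings it below d; a monic f makes this possible without
  -- inverses.
  divMod : ∀ {f d} → Monic f d → ∀ a → ∃ λ s → ∃ λ r → a ≋ s ⊗ f ⊕ r × Below r d
  divMod mf [] = [] , [] , ≋-refl , λ _ _ → refl
  divMod {f} {d} mf (c ∷ a) with divMod mf a
  ... | s , r , a≋ , r<d = t ∷ s , u ⊕ (- t) ⊙ f , eq , Below-suc (u ⊕ (- t) ⊙ f) (Below-⊕ {u} {(- t) ⊙ f} u≤d (Below-⊙ (- t) {f} (bounded mf))) cancel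
    where
    u = c ∷ r
    t = coeff u d
    u≤d : Below u (suc d)
    u≤d (suc i) (s≤s d≤i) = r<d i d≤i
    cancel : coeff (u ⊕ (- t) ⊙ f) d ≈ 0#
    cancel = begin
      coeff (u ⊕ (- t) ⊙ f) d  ≈⟨ trans (coeff-⊕ u ((- t) ⊙ f) d) (+-congˡ (coeff-⊙ (- t) f d)) ⟩
      t + - t * coeff f d      ≈⟨ +-congˡ (trans (*-congˡ (leading mf)) (*-identityʳ (- t))) ⟩
      t + - t                  ≈⟨ -‿inverseʳ t ⟩
      0#                       ∎
    shift : c ∷ a ≋ (0# ∷ s ⊗ f) ⊕ u
    shift = ∷-cong (sym (+-identityˡ c)) a≋
    opposite : t ⊙ f ⊕ (- t) ⊙ f ≋ []
    opposite = ≋-trans (≋-sym (⊙-distribʳ t (- t) f)) (≋-trans (⊙-cong (-‿inverseʳ t) ≋-refl) (⊙-zero f))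
    eq : c ∷ a ≋ (t ⊙ f ⊕ (0# ∷ s ⊗ f)) ⊕ (u ⊕ (- t) ⊙ f)
    eq = ≋-trans shift (≋-sym (≋-trans (⊕-cong (≋-refl {t ⊙ f ⊕ (0# ∷ s ⊗ f)}) (⊕-comm u ((- t) ⊙ f)))
      (≋-trans (⊕-interchange (t ⊙ f) (0# ∷ s ⊗ f) ((- t) ⊙ f) u) (⊕-cong opposite (≋-refl {(0# ∷ s ⊗ f) ⊕ u})))))

  -- The topmost possible coefficient of h equals one of f h that vanishes. The descent starts from
  -- the length of the list, a trivial degree bound.
  Below-cancel : ∀ {f d} → Monic f d → ∀ h {m} → Below (f ⊗ h) (d ℕ.+ m) → Below h m
  Below-cancel {f} {d} mf h {m} fh<d+m = lower (List.length h) (Below-mono {h} (ℕ.m≤n+m _ m) (Below-length h))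
    where
    lower : ∀ k → Below h (m ℕ.+ k) → Below h m
    lower zero    h<m = ≡.subst (Below h) (ℕ.+-identityʳ m) h<m
    lower (suc k) h≤m+k = lower k (Below-suc h h<m+k (begin
      coeff h (m ℕ.+ k)                  ≈⟨ *-identityˡ _ ⟨
      1# * coeff h (m ℕ.+ k)             ≈⟨ *-congʳ (leading mf) ⟨
      coeff f d * coeff h (m ℕ.+ k)      ≈⟨ coeff-⊗-top f h (bounded mf) h<m+k ⟨
      coeff (f ⊗ h) (d ℕ.+ (m ℕ.+ k))    ≈⟨ fh<d+m _ (ℕ.+-monoʳ-≤ d (ℕ.m≤m+n m k)) ⟩
      0#                                 ∎))
      where
      h<m+k : Below h (suc (m ℕ.+ k))
      h<m+k = ≡.subst (Below h) (ℕ.+-suc m k) h≤m+k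

-- Divisibility and congruences

module Divisibility (R : CommutativeRing 0ℓ 0ℓ) where
  open CommutativeRing R hiding (zero)
  open import Algebra.Properties.Ring ring using ([y-z]x≈yx-zx)
  open import Algebra.Properties.Semiring.Divisibility semiring public
    using (_∣_; _,_; ∣-refl; ∣-trans; 1∣_)
  open import Algebra.Properties.Magma.Divisibility *-magma public using (∣ʳ-respʳ-≈; ∣ʳ-respˡ-≈)
  open Quotient R using (_~_; _,_)
  open import Relation.Binary.Reasoning.Setoid setoid

  x∣y⇒x∣z*y : ∀ {x y} z → x ∣ y → x ∣ z * y
  x∣y⇒x∣z*y z (q , qx≈y) = z * q , trans (*-assoc z q _) (*-congˡ qx≈y)

  x∣y⇒x∣y*z : ∀ {x y} z → x ∣ y → x ∣ y * z
  x∣y⇒x∣y*z z x∣y = ∣ʳ-respʳ-≈ (*-comm z _) (x∣y⇒x∣z*y z x∣y)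

  x∣y∧x∣y+z⇒x∣z : ∀ {x y z} → x ∣ y → x ∣ y + z → x ∣ z
  x∣y∧x∣y+z⇒x∣z {x} {y} {z} (q , qx≈y) (r , rx≈y+z) = r - q , (begin
    (r - q) * x    ≈⟨ [y-z]x≈yx-zx x r q ⟩
    r * x - q * x  ≈⟨ +-cong (trans rx≈y+z (+-comm y z)) (-‿cong qx≈y) ⟩
    z + y - y      ≈⟨ +-assoc z y (- y) ⟩
    z + (y - y)    ≈⟨ trans (+-congˡ (-‿inverseʳ y)) (+-identityʳ z) ⟩
    z              ∎)

  ~⇒∣- : ∀ {c a b} → _~_ c a b → c ∣ a - b
  ~⇒∣- {c} {a} {b} (q , a≈b+qc) = q , sym (begin
    a - b            ≈⟨ +-congʳ (trans a≈b+qc (+-comm b (q * c))) ⟩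
    q * c + b - b    ≈⟨ +-assoc _ b (- b) ⟩
    q * c + (b - b)  ≈⟨ trans (+-congˡ (-‿inverseʳ b)) (+-identityʳ _) ⟩
    q * c            ∎)

  ∣-⇒~ : ∀ {c a b} → c ∣ a - b → _~_ c a b
  ∣-⇒~ {c} {a} {b} (q , qc≈a-b) = q , sym (begin
    b + q * c        ≈⟨ trans (+-comm b _) (+-congʳ qc≈a-b) ⟩
    a - b + b        ≈⟨ +-assoc a (- b) b ⟩
    a + (- b + b)    ≈⟨ trans (+-congˡ (-‿inverseˡ b)) (+-identityʳ a) ⟩
    a                ∎)

  ∣⇒~0 : ∀ {c a} → c ∣ a → _~_ c a 0#
  ∣⇒~0 (q , qc≈a) = q , trans (sym qc≈a) (sym (+-identityˡ _))

  ~0⇒∣ : ∀ {c a} → _~_ c a 0# → c ∣ a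
  ~0⇒∣ (q , a≈0+qc) = q , trans (sym (+-identityˡ _)) (sym a≈0+qc)

  ~-coarsen : ∀ {c d a b} → d ∣ c → _~_ c a b → _~_ d a b
  ~-coarsen {c} {d} {a} {b} (h , hd≈c) (q , a≈b+qc) = q * h , trans a≈b+qc (+-congˡ (trans (*-congˡ (sym hd≈c)) (sym (*-assoc q h d))))

funToFin-cong : ∀ {m n} {f g : Fin m → Fin n} → f ≗ g → Fin.funToFin f ≡ Fin.funToFin g
funToFin-cong {zero}  f≗g = ≡.refl
funToFin-cong {suc m} f≗g = ≡.cong₂ Fin.combine (f≗g zero) (funToFin-cong (f≗g ∘ suc))

-- Polynomials over a finite field: irreducibility and residue fields

module FieldPolynomials (F : FiniteDomain) where
  open FiniteDomain F
  open FiniteDomainProperties F using (_≈?_; invertible)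
  open Polynomials commutativeRing public
  open Divisibility polynomialRing public
  open import Algebra.Properties.Ring (CommutativeRing.ring polynomialRing) using (x∙y⁻¹≈ε⇒x≈y)
  module P = CommutativeRing polynomialRing

  Monic-≋[] : ∀ {p d} → Monic p d → ¬ p ≋ []
  Monic-≋[] {d = d} mp p≋0 = 1≉0 (trans (sym (leading mp)) (at p≋0 d))

  Monic-0 : ∀ {p} → Monic p 0 → p ≋ one
  Monic-0 mp .at zero    = leading mp
  Monic-0 mp .at (suc i) = bounded mp (suc i) (s≤s z≤n)

  multiple-Below : ∀ {f d} → Monic f d → ∀ h → Below (h ⊗ f) d → h ≋ []
  multiple-Below {f} {d} mf h hf<d = Below-0 (Below-cancel mf h (≡.subst (Below (f ⊗ h)) (≡.sym (ℕ.+-identityʳ d)) (Below-resp (⊗-comm h f) hf<d)))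

  ∣-Below : ∀ {f a d} → Monic f d → f ∣ a → Below a d → a ≋ []
  ∣-Below mf (h , hf≋a) a<d = ≋-trans (≋-sym hf≋a) (⊗-zeroˡ h (multiple-Below mf h (Below-resp (≋-sym hf≋a) a<d)))

  -- Uniqueness of remainders: the difference is a multiple of f of degree below d, hence zero.
  ~-Below : ∀ {f a b d} → Monic f d → Below a d → Below b d → Quotient._~_ polynomialRing f a b → a ≋ b
  ~-Below {f} {a} {b} mf a<d b<d a~b = x∙y⁻¹≈ε⇒x≈y a b (∣-Below mf (~⇒∣- a~b) (Below-⊕ {a} {⊖ b} a<d (Below-⊖ {b} b<d)))

  Monic-quotient : ∀ {f b d e} → Monic f d → Monic b e → ∀ h → h ⊗ f ≋ b → ∃ λ m → e ≡ m ℕ.+ d × Monic h m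
  Monic-quotient {f} {b} {d} {e} mf mb h hf≋b with d ℕ.≤? e
  ... | no d≰e = contradiction (∣-Below mf (h , hf≋b) (Below-mono {b} (ℕ.≰⇒> d≰e) (bounded mb))) (Monic-≋[] mb)
  ... | yes d≤e = e ∸ d , ≡.sym (ℕ.m∸n+n≡m d≤e) , monic lead h≤m
    where
    open import Relation.Binary.Reasoning.Setoid setoid
    d+m≡e : d ℕ.+ (e ∸ d) ≡ e
    d+m≡e = ℕ.m+[n∸m]≡n d≤e
    fh≋b : f ⊗ h ≋ b
    fh≋b = ≋-trans (⊗-comm f h) hf≋b
    h≤m : Below h (suc (e ∸ d))
    h≤m = Below-cancel mf h (≡.subst (Below (f ⊗ h)) (≡.sym (≡.trans (ℕ.+-suc d (e ∸ d)) (≡.cong suc d+m≡e))) (Below-resp (≋-sym fh≋b) (bounded mb)))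
    lead : coeff h (e ∸ d) ≈ 1#
    lead = begin
      coeff h (e ∸ d)                ≈⟨ *-identityˡ _ ⟨
      1# * coeff h (e ∸ d)           ≈⟨ *-congʳ (leading mf) ⟨
      coeff f d * coeff h (e ∸ d)    ≈⟨ coeff-⊗-top f h (bounded mf) h≤m ⟨
      coeff (f ⊗ h) (d ℕ.+ (e ∸ d))  ≡⟨ ≡.cong (coeff (f ⊗ h)) d+m≡e ⟩
      coeff (f ⊗ h) e                ≈⟨ at fh≋b e ⟩
      coeff b e                      ≈⟨ leading mb ⟩
      1#                             ∎

  ≋[]? : ∀ p → Dec (p ≋ [])
  ≋[]? [] = yes ≋-refl
  ≋[]? (a ∷ p) with a ≈? 0# | ≋[]? p
  ... | yes a≈0 | yes p≋0 = yes (≋-trans (∷-cong a≈0 p≋0) 0∷[]≋[])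
  ... | no a≉0  | _       = no λ h → a≉0 (at h zero)
  ... | yes _   | no p≋̸0  = no λ h → p≋̸0 (pointwise (at h ∘ suc))

  ∣? : ∀ {f d} → Monic f d → ∀ a → Dec (f ∣ a)
  ∣? {f} mf a with divMod mf a
  ... | s , r , a≋sf+r , r<d = map′
    (λ r≋0 → s , ≋-sym (≋-trans a≋sf+r (≋-trans (⊕-cong (≋-refl {s ⊗ f}) r≋0) (⊕-identityʳ _))))
    (λ f∣a → ∣-Below mf (x∣y∧x∣y+z⇒x∣z (s , ≋-refl) (∣ʳ-respʳ-≈ a≋sf+r f∣a)) r<d)
    (≋[]? r)

  -- `divMod` divides by monic polynomials only, so Euclid's algorithm has to normalise each nonzero
  -- remainder. The leading coefficient is found by searching downwards from the bound d.
  monicMultiple : ∀ r d → Below r d → r ≋ [] ⊎ (∃ λ c → ∃ λ e → e < d × Monic (c ⊙ r) e)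
  monicMultiple r zero r<0 = inj₁ (Below-0 r<0)
  monicMultiple r (suc d) r≤d with coeff r d ≈? 0#
  ... | yes top≈0 = Sum.map₂ (λ { (c , e , e<d , mr) → c , e , ℕ.m<n⇒m<1+n e<d , mr }) (monicMultiple r d (Below-suc r r≤d top≈0))
  ... | no top≉0 with invertible top≉0
  ...   | c , c*top≈1 = inj₂ (c , d , ℕ.≤-refl , monic (trans (coeff-⊙ c r d) c*top≈1) (Below-⊙ c {r} r≤d))

  fromCoefficients : ∀ {d} → (Fin d → Carrier) → Polynomial
  fromCoefficients = List.tabulate

  coeff-fromCoefficients : ∀ {d} (φ : Fin d → Carrier) j → coeff (fromCoefficients φ) (toℕ j) ≡ φ j
  coeff-fromCoefficients φ zero    = ≡.refl
  coeff-fromCoefficients φ (suc j) = coeff-fromCoefficients (φ ∘ suc) j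

  Below-fromCoefficients : ∀ {d} (φ : Fin d → Carrier) → Below (fromCoefficients φ) d
  Below-fromCoefficients φ = ≡.subst (Below (fromCoefficients φ)) (List.length-tabulate φ) (Below-length (fromCoefficients φ))
    where import Data.List.Properties as List

  fromCoefficients≋ : ∀ {d} (φ : Fin d → Carrier) {r} → Below r d → (∀ j → φ j ≈ coeff r (toℕ j)) → fromCoefficients φ ≋ r
  fromCoefficients≋ {d} φ {r} r<d φ≈r .at i with i ℕ.<? d
  ... | yes i<d = ≡.subst (λ i → coeff (fromCoefficients φ) i ≈ coeff r i) (Fin.toℕ-fromℕ< i<d)
    (trans (reflexive (coeff-fromCoefficients φ (Fin.fromℕ< i<d))) (φ≈r (Fin.fromℕ< i<d)))
  ... | no i≮d = trans (Below-fromCoefficients φ i (ℕ.≮⇒≥ i≮d)) (sym (r<d i (ℕ.≮⇒≥ i≮d)))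

  -- The digits of c in base `order` become the coefficients, one for each polynomial of degree
  -- below d.
  decode : ∀ d → Fin (order ℕ.^ d) → Polynomial
  decode d c = fromCoefficients (element ∘ Fin.finToFun {order} {d} c)

  encode : ∀ d → Polynomial → Fin (order ℕ.^ d)
  encode d r = Fin.funToFin {d} λ j → index (coeff r (toℕ j))

  decode-encode : ∀ d {r} → Below r d → decode d (encode d r) ≋ r
  decode-encode d {r} r<d = fromCoefficients≋ _ r<d λ j →
    trans (reflexive (≡.cong element (Fin.finToFun-funToFin (λ j → index (coeff r (toℕ j))) j))) (element-index _)

  encode-cong : ∀ d {r s} → r ≋ s → encode d r ≡ encode d s
  encode-cong d r≋s = funToFin-cong {d} λ j → index-cong (at r≋s (toℕ j))

  encode-decode : ∀ d c → encode d (decode d c) ≡ c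
  encode-decode d c = ≡.trans
    (funToFin-cong {d} λ j → ≡.trans (≡.cong index (coeff-fromCoefficients _ j)) (index-element (Fin.finToFun {order} {d} c j)))
    (Fin.funToFin-finToFin {d} {order} c)

  -- Up to `_≋_` these are all the monic polynomials of degree d, so a search for factors is finite.
  Monic-X^⊕decode : ∀ d c → Monic (X ^ d ⊕ decode d c) d
  Monic-X^⊕decode d c = Monic-⊕ {q = decode d c} (Monic-X^ d) (Below-fromCoefficients (element ∘ Fin.finToFun {order} {d} c))

  record Irreducible (f : Polynomial) (d : ℕ) : Set where
    field
      monicity    : Monic f d
      nonconstant : 0 < d
      no-factor   : ∀ {g e} → Monic g e → e < d → g ∣ f → e ≡ 0
  open Irreducible public

  -- Look for a monic divisor of degree strictly between 0 and e: none means that b is irreducible,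
  -- and otherwise the search continues inside the divisor found. The fuel n bounds the degree.
  irreducibleFactor : ∀ n {b e} → e < n → Monic b e → 0 < e → ∃ λ f → ∃ λ d → Irreducible f d × f ∣ b
  irreducibleFactor (suc n) {b} {e} e<n mb 0<e with
    Fin.any? (λ (i : Fin e) → Fin.any? λ c → (0 ℕ.<? toℕ i) ×-dec ∣? (Monic-X^⊕decode (toℕ i) c) b)
    where open import Relation.Nullary.Decidable using (_×-dec_)
  ... | yes (i , c , 0<i , g∣b) with irreducibleFactor n (ℕ.<-≤-trans (Fin.toℕ<n i) (ℕ.s≤s⁻¹ e<n)) (Monic-X^⊕decode (toℕ i) c) 0<i
  ...   | f , d , irr , f∣g = f , d , irr , ∣-trans f∣g g∣b
  irreducibleFactor (suc n) {b} {e} e<n mb 0<e | no none = b , e , record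
    { monicity = mb ; nonconstant = 0<e ; no-factor = λ { {g} {zero} _ _ _ → ≡.refl ; {g} {suc j} mg j<e g∣b → contradiction (reducible mg j<e g∣b) none } } , ∣-refl
    where
    reducible : ∀ {g j} → Monic g (suc j) → suc j < e → g ∣ b → _
    reducible {g} {j} mg j<e g∣b = Fin.fromℕ< j<e , ≡.subst (λ i → ∃ λ c → 0 < i × (X ^ i ⊕ decode i c) ∣ b) (≡.sym (Fin.toℕ-fromℕ< j<e))
      (encode (suc j) lower , s≤s z≤n , ∣ʳ-respˡ-≈ (≋-sym split) g∣b)
      where
      xʲ : Polynomial
      xʲ = X ^ suc j
      lower : Polynomial
      lower = g ⊕ ⊖ xʲ
      lower<j : Below lower (suc j)
      lower<j = Below-suc lower (Below-⊕ {g} {⊖ xʲ} (bounded mg) (Below-⊖ {xʲ} (bounded (Monic-X^ (suc j)))))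
        (trans (coeff-⊕ g (⊖ xʲ) (suc j)) (trans (+-cong (leading mg) (trans (coeff-⊖ xʲ (suc j)) (-‿cong (leading (Monic-X^ (suc j)))))) (-‿inverseʳ 1#)))
      split : xʲ ⊕ decode (suc j) (encode (suc j) lower) ≋ g
      split = ≋-trans (⊕-cong (≋-refl {xʲ}) (≋-trans (decode-encode (suc j) lower<j) (⊕-comm g (⊖ xʲ))))
        (≋-trans (≋-sym (⊕-assoc xʲ (⊖ xʲ) g)) (⊕-cong (⊕-inverseʳ xʲ) (≋-refl {g})))

  module _ {f d} (irr : Irreducible f d) where

    -- Division of f by a leaves a remainder of smaller degree with the same property, as in Euclid's algorithm.
    f∣a⊗b⇒f∣b : ∀ n {a e} b → e < n → Monic a e → e < d → f ∣ a ⊗ b → f ∣ b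
    f∣a⊗b⇒f∣b (suc n) {a} {e} b e<n ma e<d f∣ab with divMod ma f
    ... | s , r , f≋sa+r , r<e with monicMultiple r e r<e
    ...   | inj₁ r≋0 = ∣ʳ-respʳ-≈ (≋-trans (⊗-congʳ a one a≋1) (⊗-identityˡ b)) f∣ab
      where
      a∣f : a ∣ f
      a∣f = s , ≋-sym (≋-trans f≋sa+r (≋-trans (⊕-cong (≋-refl {s ⊗ a}) r≋0) (⊕-identityʳ _)))
      a≋1 : a ≋ one
      a≋1 = Monic-0 (≡.subst (Monic a) (no-factor irr ma e<d a∣f) ma)
    ...   | inj₂ (c , e′ , e′<e , mr) = f∣a⊗b⇒f∣b n b (ℕ.<-≤-trans e′<e (ℕ.s≤s⁻¹ e<n)) mr (ℕ.<-trans e′<e e<d) f∣crb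
      where
      f∣rb : f ∣ r ⊗ b
      f∣rb = x∣y∧x∣y+z⇒x∣z (x∣y⇒x∣z*y s f∣ab) (∣ʳ-respʳ-≈ (≋-trans (⊗-congʳ f (s ⊗ a ⊕ r) f≋sa+r)
        (≋-trans (⊗-distribʳ b (s ⊗ a) r) (⊕-cong (⊗-assoc s a b) (≋-refl {r ⊗ b})))) (x∣y⇒x∣y*z b (∣-refl {f})))
      f∣crb : f ∣ (c ⊙ r) ⊗ b
      f∣crb = ∣ʳ-respʳ-≈ (≋-trans (const⊗ c (r ⊗ b)) (≋-sym (⊙-⊗ c r b))) (x∣y⇒x∣z*y (c ∷ []) f∣rb)

    -- If the remainder of a modulo f is nonzero, its monic multiple has degree below d and
    -- `f∣a⊗b⇒f∣b` applies to it.
    euclid : ∀ {a b} → f ∣ a ⊗ b → f ∣ a ⊎ f ∣ b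
    euclid {a} {b} f∣ab with divMod (monicity irr) a
    ... | s , r , a≋sf+r , r<d with monicMultiple r d r<d
    ...   | inj₁ r≋0 = inj₁ (s , ≋-sym (≋-trans a≋sf+r (≋-trans (⊕-cong (≋-refl {s ⊗ f}) r≋0) (⊕-identityʳ _))))
    ...   | inj₂ (c , e , e<d , mr) = inj₂ (f∣a⊗b⇒f∣b (suc e) b ℕ.≤-refl mr e<d f∣crb)
      where
      f∣rb : f ∣ r ⊗ b
      f∣rb = x∣y∧x∣y+z⇒x∣z (x∣y⇒x∣y*z b (x∣y⇒x∣z*y s (∣-refl {f})))
        (∣ʳ-respʳ-≈ (≋-trans (⊗-congʳ a (s ⊗ f ⊕ r) a≋sf+r) (⊗-distribʳ b (s ⊗ f) r)) f∣ab)
      f∣crb : f ∣ (c ⊙ r) ⊗ b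
      f∣crb = ∣ʳ-respʳ-≈ (≋-trans (const⊗ c (r ⊗ b)) (≋-sym (⊙-⊗ c r b))) (x∣y⇒x∣z*y (c ∷ []) f∣rb)

    open Quotient polynomialRing f using (_~_; _,_; ≈⇒~; ~-sym; ~-trans; quotientRing)

    remainder : Polynomial → Polynomial
    remainder a = proj₁ (proj₂ (divMod (monicity irr) a))

    remainder<d : ∀ a → Below (remainder a) d
    remainder<d a = proj₂ (proj₂ (proj₂ (divMod (monicity irr) a)))

    a~remainder : ∀ a → a ~ remainder a
    a~remainder a = let s , r , a≋sf+r , _ = divMod (monicity irr) a in s , ≋-trans a≋sf+r (⊕-comm (s ⊗ f) r)

    -- Each class is represented by its remainder of degree below d, hence order^d elements;
    -- `euclid` excludes zero divisors.
    residueField : FiniteDomain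
    residueField = record
      { commutativeRing = quotientRing
      ; order = order ℕ.^ d
      ; element = decode d
      ; index = encode d ∘ remainder
      ; index-cong = λ {a} {b} a~b → encode-cong d (~-Below (monicity irr) (remainder<d a) (remainder<d b)
          (~-trans (~-sym (a~remainder a)) (~-trans a~b (a~remainder b))))
      ; element-index = λ a → ~-trans (≈⇒~ (decode-encode d (remainder<d a))) (~-sym (a~remainder a))
      ; index-element = λ c → ≡.trans (encode-cong d (~-Below (monicity irr) (remainder<d (decode d c)) (Below-fromCoefficients _) (~-sym (a~remainder (decode d c)))))
          (encode-decode d c)
      ; x*y≈0⇒x≈0∨y≈0 = λ xy~0 → Sum.map ∣⇒~0 ∣⇒~0 (euclid (~0⇒∣ xy~0))
      ; 1≉0 = λ 1~0 → Monic-≋[] Monic-one (∣-Below (monicity irr) (~0⇒∣ 1~0) (Below-mono {one} (nonconstant irr) (bounded Monic-one)))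
      }

-- Finite fields of prime power order

module QuotientPowers (R : CommutativeRing 0ℓ 0ℓ) (c : CommutativeRing.Carrier R) where
  open CommutativeRing R hiding (zero)
  open Quotient R c using (quotientRing)
  private module Q = CommutativeRing quotientRing

  -- Both rings share their multiplication, but their powers are recursions over different semiring
  -- records and agree only by induction on n.
  ^-quotient : ∀ x n → Exp._^_ Q.semiring x n ≡ Exp._^_ semiring x n
  ^-quotient x zero    = ≡.refl
  ^-quotient x (suc n) = ≡.cong (x *_) (^-quotient x n)

  ×-quotient : ∀ n x → Mult._×_ Q.semiring n x ≡ Mult._×_ semiring n x
  ×-quotient zero    x = ≡.refl
  ×-quotient (suc n) x = ≡.cong (x +_) (×-quotient n x)

module IrreducibleOfDegree (F : FiniteDomain) (pr : Prime (FiniteDomain.order F))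
  (order·1≈0 : FiniteDomain._≈_ F (Mult._×_ (FiniteDomain.semiring F) (FiniteDomain.order F) (FiniteDomain.1# F)) (FiniteDomain.0# F)) where
  open FiniteDomain F using (_≈_; 1#; semiring; sym; trans; *-identityʳ) renaming (order to p)
  open FiniteDomainProperties F using (a^order≈a)
  open FieldPolynomials F
  module FExp = Exp semiring
  module PExp = Exp P.semiring
  open Quotient polynomialRing using (_~_)

  -- The roots of X^(p^k) - X in an extension form the field with p^k elements.
  X^p^k-X : ℕ → Polynomial
  X^p^k-X k = X ^ (p ℕ.^ k) ⊕ ⊖ X

  p>1 : 1 < p
  p>1 = ℕ.nonTrivial⇒n>1 p {{prime⇒nonTrivial pr}}

  p^k>1 : ∀ {k} → 0 < k → 1 < p ℕ.^ k
  p^k>1 {suc k} _ = ℕ.<-≤-trans p>1 (ℕ.m≤m*n p (p ℕ.^ k) {{ℕ.m^n≢0 p k {{ℕ.>-nonZero (ℕ.<⇒≤ p>1)}}}})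

  p^k>0 : ∀ k → 0 < p ℕ.^ k
  p^k>0 k = ℕ.m^n>0 p {{ℕ.>-nonZero (ℕ.<⇒≤ p>1)}} k

  p^-strictMono : ∀ {i j} → i < j → p ℕ.^ i < p ℕ.^ j
  p^-strictMono = ℕ.^-monoʳ-< p p>1

  Monic-X^p^k-X : ∀ {k} → 0 < k → Monic (X^p^k-X k) (p ℕ.^ k)
  Monic-X^p^k-X {k} 0<k = Monic-⊕ {q = ⊖ X} (Monic-X^ (p ℕ.^ k)) (Below-⊖ {X} (Below-mono {X} (p^k>1 0<k) (bounded Monic-X)))

  a^p^k≈a : ∀ k a → a FExp.^ (p ℕ.^ k) ≈ a
  a^p^k≈a zero a = *-identityʳ a
  a^p^k≈a (suc k) a = trans (sym (FExp.^-assocʳ a p (p ℕ.^ k))) (trans (FExp.^-congˡ (p ℕ.^ k) (a^order≈a a)) (a^p^k≈a k a))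

  const-^ : ∀ a n → (a ∷ []) ^ n ≋ (a FExp.^ n) ∷ []
  const-^ a zero    = ≋-refl
  const-^ a (suc n) = ≋-trans (⊗-congˡ (a ∷ []) (const-^ a n)) (const⊗ a (a FExp.^ n ∷ []))

  n·one : ∀ n → Mult._×_ P.semiring n one ≋ Mult._×_ semiring n 1# ∷ []
  n·one zero    = ≋-sym 0∷[]≋[]
  n·one (suc n) = ⊕-cong (≋-refl {one}) (n·one n)

  p·one≋[] : Mult._×_ P.semiring p one ≋ []
  p·one≋[] = ≋-trans (n·one p) (≋-trans (∷-cong order·1≈0 ≋-refl) 0∷[]≋[])

  module _ (k : ℕ) where
    open Quotient polynomialRing (X^p^k-X k) using (quotientRing; ≈⇒~)
    open QuotientPowers polynomialRing (X^p^k-X k)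
    module Q = CommutativeRing quotientRing
    open import Algebra.Properties.CommutativeSemiring.Exp Q.commutativeSemiring using (^-distrib-*) renaming (_^_ to _^Q_)
    open import Relation.Binary.Reasoning.Setoid Q.setoid

    private N = p ℕ.^ k

    0^n~0 : ∀ n → 0 < n → [] ^Q n Q.≈ []
    0^n~0 (suc n) _ = Q.zeroˡ ([] ^Q n)

    X^N~X : X ^ N Q.≈ X
    X^N~X = ∣-⇒~ {X^p^k-X k} {X ^ N} {X} ∣-refl

    -- Modulo X^N - X the N-th power is additive by Frobenius, multiplicative, and fixes both
    -- constants and X; hence it fixes a + X g once it fixes g.
    power~self : ∀ g → g ^Q N Q.≈ g
    power~self [] = 0^n~0 N (p^k>0 k)
    power~self (a ∷ g) = begin
      (a ∷ g) ^Q N                       ≡⟨ ^-quotient (a ∷ g) N ⟩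
      (a ∷ g) ^ N                        ≈⟨ ≈⇒~ (PExp.^-congˡ N (∷≋const+X⊗ a g)) ⟩
      ((a ∷ []) ⊕ X ⊗ g) ^ N             ≡⟨ ^-quotient ((a ∷ []) ⊕ X ⊗ g) N ⟨
      ((a ∷ []) ⊕ X ⊗ g) ^Q N            ≈⟨ frobenius-iterate pr p·1~0 k (a ∷ []) (X ⊗ g) ⟩
      (a ∷ []) ^Q N ⊕ (X ⊗ g) ^Q N       ≈⟨ Q.+-cong const~self (^-distrib-* X g N) ⟩
      (a ∷ []) ⊕ X ^Q N ⊗ g ^Q N         ≈⟨ Q.+-congˡ {a ∷ []} (Q.*-cong X~self (power~self g)) ⟩
      (a ∷ []) ⊕ X ⊗ g                   ≈⟨ ≈⇒~ (∷≋const+X⊗ a g) ⟨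
      a ∷ g                              ∎
      where
      open Frobenius quotientRing using (frobenius-iterate)
      p·1~0 : Mult._×_ Q.semiring p one Q.≈ []
      p·1~0 = ≡.subst (Q._≈ []) (≡.sym (×-quotient p one)) (≈⇒~ p·one≋[])
      const~self : (a ∷ []) ^Q N Q.≈ a ∷ []
      const~self = ≡.subst (Q._≈ a ∷ []) (≡.sym (^-quotient (a ∷ []) N)) (≈⇒~ (≋-trans (const-^ a N) (∷-cong (a^p^k≈a k a) ≋-refl)))
      X~self : X ^Q N Q.≈ X
      X~self = ≡.subst (Q._≈ X) (≡.sym (^-quotient X N)) X^N~X

    g^N~g : ∀ g → _~_ (X^p^k-X k) (g ^ N) g
    g^N~g g = ≡.subst (Q._≈ g) (^-quotient g N) (power~self g)

  -- Modulo f² one would have f = f^(p^k) = 0, as p^k is at least 2. So f² would divide f, against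
  -- degrees.
  squareFree : ∀ {k f d} → 0 < k → Monic f d → 0 < d → ¬ f ⊗ f ∣ X^p^k-X k
  squareFree {k} {f} {d} 0<k mf 0<d ff∣A = Monic-≋[] mf (∣-Below (Monic-⊗ mf mf) ff∣f (Below-mono {f} (ℕ.+-monoˡ-≤ d 0<d) (bounded mf)))
    where
    ff∣f^n : ∀ n → 1 < n → f ⊗ f ∣ f ^ n
    ff∣f^n (suc (suc n)) _ = ∣ʳ-respʳ-≈ (⊗-assoc f f (f ^ n)) (x∣y⇒x∣y*z (f ^ n) ∣-refl)
    ff∣f^n (suc zero) (s≤s ())
    ff∣f : f ⊗ f ∣ f
    ff∣f = ~0⇒∣ (Quotient.~-trans polynomialRing (f ⊗ f)
      (Quotient.~-sym polynomialRing (f ⊗ f) (~-coarsen ff∣A (g^N~g k f)))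
      (∣⇒~0 (ff∣f^n (p ℕ.^ k) (p^k>1 0<k))))

  module _ {f d} (irr : Irreducible f d) where
    open QuotientPowers polynomialRing f

    -- All p^d elements of the residue field satisfy a^(p^k) = a, and counting roots gives p^d ≤
    -- p^k.
    degree≤k : ∀ {k} → 0 < k → f ∣ X^p^k-X k → d ≤ k
    degree≤k {k} 0<k f∣A = ℕ.≮⇒≥ λ k<d → ℕ.<⇒≱ (p^-strictMono k<d)
      (FiniteDomainProperties.order≤exponent (residueField irr) (p^k>1 0<k)
        λ a → ≡.subst (λ b → _~_ f b a) (≡.sym (^-quotient a (p ℕ.^ k))) (~-coarsen f∣A (g^N~g k a)))

    -- The identity a^order = a for the class of X in the residue field.
    f∣X^p^d-X : f ∣ X^p^k-X d
    f∣X^p^d-X = ~⇒∣- (≡.subst (λ b → _~_ f b X) (^-quotient X (p ℕ.^ d)) (FiniteDomainProperties.a^order≈a (residueField irr) X))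

  -- The factors start at exponent 1, because `X^p^k-X 0` is the zero polynomial.
  productUpTo : ℕ → Polynomial
  productUpTo zero    = one
  productUpTo (suc j) = productUpTo j ⊗ X^p^k-X (suc j)

  -- The degree is p + ... + p^j, which stays below p^(j+1) because p ≥ 2.
  Monic-productUpTo : ∀ j → ∃ λ s → Monic (productUpTo j) s × s < p ℕ.^ suc j
  Monic-productUpTo zero = 0 , Monic-one , p^k>0 1
  Monic-productUpTo (suc j) with Monic-productUpTo j
  ... | s , ms , s<p^ = s ℕ.+ p ℕ.^ suc j , Monic-⊗ ms (Monic-X^p^k-X {suc j} (s≤s z≤n)) , (begin-strict
    s ℕ.+ p ℕ.^ suc j              <⟨ ℕ.+-monoˡ-< (p ℕ.^ suc j) s<p^ ⟩
    p ℕ.^ suc j ℕ.+ p ℕ.^ suc j    ≡⟨ ≡.cong (p ℕ.^ suc j ℕ.+_) (ℕ.+-identityʳ _) ⟨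
    2 ℕ.* p ℕ.^ suc j              ≤⟨ ℕ.*-monoˡ-≤ (p ℕ.^ suc j) p>1 ⟩
    p ℕ.^ suc (suc j)              ∎)
    where open ℕ.≤-Reasoning

  ∣productUpTo : ∀ {d j} → 0 < d → d ≤ j → X^p^k-X d ∣ productUpTo j
  ∣productUpTo {d} {zero} 0<d d≤0 = contradiction d≤0 (ℕ.<⇒≱ 0<d)
  ∣productUpTo {d} {suc j} 0<d d≤j with ℕ.m≤n⇒m<n∨m≡n d≤j
  ... | inj₁ d<j    = x∣y⇒x∣y*z (X^p^k-X (suc j)) (∣productUpTo 0<d (ℕ.s≤s⁻¹ d<j))
  ... | inj₂ ≡.refl = x∣y⇒x∣z*y (productUpTo j) ∣-refl

  module _ (j : ℕ) where
    private
      k = suc j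
      A = X^p^k-X k
      D = productUpTo j

    A∤D : ¬ A ∣ D
    A∤D (h , hA≋D) = let s , ms , s<p^k = Monic-productUpTo j
                         m , s≡m+p^k , _ = Monic-quotient (Monic-X^p^k-X {k} (s≤s z≤n)) ms h hA≋D
                     in ℕ.<⇒≱ s<p^k (≡.subst (p ℕ.^ k ≤_) (≡.sym s≡m+p^k) (ℕ.m≤n+m (p ℕ.^ k) m))

    -- Write D = g c. The irreducible f divides D but not c, or else f² would divide A; hence f
    -- divides g.
    ∣D-step : ∀ {f d b c} → Irreducible f d → d < k → c ⊗ f ⊗ b ≋ A → c ∣ D → c ⊗ f ∣ D
    ∣D-step {f} {d} {b} {c} irr d<k cfb≋A (g , gc≋D) = absorb (euclid irr (∣ʳ-respʳ-≈ (≋-sym gc≋D) f∣D))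
      where
      f∤c : ¬ f ∣ c
      f∤c (h , hf≋c) = squareFree {k} (s≤s z≤n) (monicity irr) (nonconstant irr) (∣ʳ-respʳ-≈ cfb≋A (x∣y⇒x∣y*z b
        (h , ≋-trans (≋-sym (⊗-assoc h f f)) (⊗-congʳ (h ⊗ f) c hf≋c))))
      f∣D : f ∣ D
      f∣D = ∣-trans (f∣X^p^d-X irr) (∣productUpTo {d} {j} (nonconstant irr) (ℕ.s≤s⁻¹ d<k))
      absorb : f ∣ g ⊎ f ∣ c → c ⊗ f ∣ D
      absorb (inj₂ f∣c) = contradiction f∣c f∤c
      absorb (inj₁ (h , hf≋g)) = h , ≋-trans (⊗-congˡ h (⊗-comm c f)) (≋-trans (≋-sym (⊗-assoc h f c)) (≋-trans (⊗-congʳ (h ⊗ f) g hf≋g) gc≋D))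

    -- Irreducible factors of A of degree < k divide D, and A is squarefree; moving them one by one from b to c keeps c ∣ D.
    findFactor : ∀ n {b c e} → e < n → Monic b e → c ⊗ b ≋ A → c ∣ D → ∃ λ f → Irreducible f k
    -- With b exhausted, c equals A, and A would divide a nonzero polynomial of smaller degree.
    findFactor (suc n) {b} {c} {zero} e<n mb cb≋A c∣D = contradiction
      (∣ʳ-respˡ-≈ (≋-trans (≋-sym (P.*-identityʳ c)) (≋-trans (⊗-congˡ c (≋-sym (Monic-0 mb))) cb≋A)) c∣D) A∤D
    findFactor (suc n) {b} {c} {suc e} e<n mb cb≋A c∣D = split (irreducibleFactor (suc (suc e)) ℕ.≤-refl mb (s≤s z≤n))
      where
      split : (∃ λ f → ∃ λ d → Irreducible f d × f ∣ b) → ∃ λ f → Irreducible f k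
      split (f , d , irr , (b′ , b′f≋b)) = [ move , (λ d≡k → f , ≡.subst (Irreducible f) d≡k irr) ]′ (ℕ.m≤n⇒m<n∨m≡n (degree≤k irr {k} (s≤s z≤n) f∣A))
        where
        f∣A : f ∣ A
        f∣A = ∣ʳ-respʳ-≈ cb≋A (x∣y⇒x∣z*y c (b′ , b′f≋b))
        cfb′≋A : c ⊗ f ⊗ b′ ≋ A
        cfb′≋A = ≋-trans (⊗-assoc c f b′) (≋-trans (⊗-congˡ c (≋-trans (⊗-comm f b′) b′f≋b)) cb≋A)
        move : d < k → ∃ λ f → Irreducible f k
        move d<k = let m , e≡m+d , mb′ = Monic-quotient (monicity irr) mb b′ b′f≋b
                       m<e = ≡.subst (m <_) (≡.sym e≡m+d) (ℕ.m<m+n m (nonconstant irr))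
                   in findFactor n (ℕ.<-≤-trans m<e (ℕ.s≤s⁻¹ e<n)) mb′ cfb′≋A (∣D-step irr d<k cfb′≋A c∣D)

    irreducibleOfDegree : ∃ λ f → Irreducible f k
    irreducibleOfDegree = findFactor (suc (p ℕ.^ k)) ℕ.≤-refl (Monic-X^p^k-X {k} (s≤s z≤n)) (⊗-identityˡ A) (1∣ D)

finiteField : ∀ {p k} → Prime p → 0 < k → ∃ λ (K : FiniteDomain) → FiniteDomain.order K ≡ p ℕ.^ k
finiteField {p} {suc j} pr _ = FieldPolynomials.residueField (modPrime) (proj₂ (irreducibleOfDegree j)) , ≡.refl
  where
  open IntegersModPrime pr
  open IrreducibleOfDegree modPrime pr p·1≈0

-- Planar ternary ring: value m x b is the ordinate at x of the line with slope m and intercept b.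
record TernaryRing (q : ℕ) : Set where
  field
    value           : Fin q → Fin q → Fin q → Fin q
    intercept       : Fin q → Fin q → Fin q → Fin q
    value-intercept : ∀ m x y → value m x (intercept m x y) ≡ y
    value-injective : ∀ {m x b b′} → value m x b ≡ value m x b′ → b ≡ b′
    two-meets       : ∀ {m b m′ b′ x x′} → value m x b ≡ value m′ x b′ → value m x′ b ≡ value m′ x′ b′ → m ≡ m′ ⊎ x ≡ x′

-- Coordinates of the plane over a finite domain

module Coordinates (D : FiniteDomain) where
  open FiniteDomain D
  open FiniteDomainProperties D
  open import Algebra.Properties.Ring ring using (+-cancelʳ; x∙y⁻¹≈ε⇒x≈y)
  open import Algebra.Solver.Ring.NaturalCoefficients.Default commutativeSemiring using (solve; _:=_; _:*_; _:+_)
  open import Relation.Binary.Reasoning.Setoid setoid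

  -- Subtracting the equations gives (m - m′)(x - x′) = 0. The solver handles semirings only, so u
  -- stands for x - x′ and all other terms are added to both sides.
  cross : ∀ {m m′ x x′ b b′} → m * x + b ≈ m′ * x + b′ → m * x′ + b ≈ m′ * x′ + b′ → m ≈ m′ ⊎ x ≈ x′
  cross {m} {m′} {x} {x′} {b} {b′} eq eq′ with (x + - x′) ≈? 0#
  ... | yes x-x′≈0 = inj₂ (x∙y⁻¹≈ε⇒x≈y x x′ x-x′≈0)
  ... | no x-x′≉0 = inj₁ (*-cancelʳ (x + - x′) x-x′≉0 (+-cancelʳ (m * x′ + m′ * x′ + b + b′) _ _ (begin
    m * u + (m * x′ + m′ * x′ + b + b′)
      ≈⟨ solve 6 (λ m m′ x′ u b b′ → m :* u :+ (m :* x′ :+ m′ :* x′ :+ b :+ b′) := (m :* (u :+ x′) :+ b) :+ (m′ :* x′ :+ b′)) refl m m′ x′ u b b′ ⟩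
    (m * (u + x′) + b) + (m′ * x′ + b′)      ≈⟨ +-cong (shift eq) (sym eq′) ⟩
    (m′ * (u + x′) + b′) + (m * x′ + b)
      ≈⟨ solve 6 (λ m m′ x′ u b b′ → (m′ :* (u :+ x′) :+ b′) :+ (m :* x′ :+ b) := m′ :* u :+ (m :* x′ :+ m′ :* x′ :+ b :+ b′)) refl m m′ x′ u b b′ ⟩
    m′ * u + (m * x′ + m′ * x′ + b + b′)     ∎)))
    where
    u = x + - x′
    u+x′≈x : u + x′ ≈ x
    u+x′≈x = trans (+-assoc x (- x′) x′) (trans (+-congˡ (-‿inverseˡ x′)) (+-identityʳ x))
    shift : m * x + b ≈ m′ * x + b′ → m * (u + x′) + b ≈ m′ * (u + x′) + b′
    shift h = trans (+-congʳ (*-congˡ u+x′≈x)) (trans h (+-congʳ (*-congˡ (sym u+x′≈x))))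

  ternaryRing : TernaryRing order
  ternaryRing = record
    { value = λ m x b → index (element m * element x + element b)
    ; intercept = λ m x y → index (element y + - (element m * element x))
    ; value-intercept = λ m x y → ≡.trans (index-cong (trans (+-congˡ (element-index _)) (trans (+-comm _ _)
        (trans (+-assoc (element y) (- (element m * element x)) _) (trans (+-congˡ (-‿inverseˡ _)) (+-identityʳ _)))))) (index-element y)
    ; value-injective = λ {m} {x} {b} {b′} eq → element-injective (+-cancelʳ (element m * element x) _ _
        (trans (+-comm _ _) (trans (index-injective eq) (+-comm _ _))))
    ; two-meets = λ eq eq′ → Sum.map element-injective element-injective (cross (index-injective eq) (index-injective eq′))
    }

-- Finite graphs

open import Data.Nat.ListAction using (sum)
open import Defs
open import Data.Nat using (_+_; _*_)

≡true⇒T : ∀ {b} → b ≡ true → T b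
≡true⇒T = Equivalence.from T-≡

T⇒≡true : ∀ {b} → T b → b ≡ true
T⇒≡true = Equivalence.to T-≡

lookup-injective : ∀ {A : Set} {xs : List A} → Unique xs → ∀ {i j} → List.lookup xs i ≡ List.lookup xs j → i ≡ j
lookup-injective {xs = x ∷ xs} (x∉xs ∷ u) {zero}  {zero}  eq = ≡.refl
lookup-injective {xs = x ∷ xs} (x∉xs ∷ u) {suc i} {suc j} eq = ≡.cong suc (lookup-injective u eq)
lookup-injective {xs = x ∷ xs} (x∉xs ∷ u) {zero}  {suc j} eq = contradiction eq (All.lookup x∉xs (∈-lookup j))
lookup-injective {xs = x ∷ xs} (x∉xs ∷ u) {suc i} {zero}  eq = contradiction (≡.sym eq) (All.lookup x∉xs (∈-lookup i))

≤-foldr-⊔ : ∀ {A : Set} (f : A → ℕ) {x xs} → x ∈ xs → f x ≤ foldr _⊔_ 0 (List.map f xs)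
≤-foldr-⊔ f {xs = _ ∷ xs} (here ≡.refl) = ℕ.m≤m⊔n (f _) _
≤-foldr-⊔ f {xs = y ∷ xs} (there x∈xs)  = ℕ.≤-trans (≤-foldr-⊔ f x∈xs) (ℕ.m≤n⊔m (f y) _)

sumFin : ∀ {n} → (Fin n → ℕ) → ℕ
sumFin {n} f = sum (List.tabulate f)

sumFin-cong : ∀ {n} {f g : Fin n → ℕ} → f ≗ g → sumFin f ≡ sumFin g
sumFin-cong f≗g = ≡.cong sum (List.tabulate-cong f≗g)

sumFin-mono : ∀ {n} {f g : Fin n → ℕ} → (∀ i → f i ≤ g i) → sumFin f ≤ sumFin g
sumFin-mono {zero}  f≤g = z≤n
sumFin-mono {suc n} f≤g = ℕ.+-mono-≤ (f≤g zero) (sumFin-mono (f≤g ∘ suc))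

sumFin-const : ∀ n c → sumFin {n} (λ _ → c) ≡ n ℕ.* c
sumFin-const zero    c = ≡.refl
sumFin-const (suc n) c = ≡.cong (c ℕ.+_) (sumFin-const n c)

sumFin-+ : ∀ {n} (f g : Fin n → ℕ) → sumFin (λ i → f i ℕ.+ g i) ≡ sumFin f ℕ.+ sumFin g
sumFin-+ {zero}  f g = ≡.refl
sumFin-+ {suc n} f g = ≡.trans (≡.cong (f zero ℕ.+ g zero ℕ.+_) (sumFin-+ (f ∘ suc) (g ∘ suc))) (interchange (f zero) (g zero) _ _)
  where open import Algebra.Properties.CommutativeSemigroup ℕ.+-commutativeSemigroup using (interchange)

sumFin-++ : ∀ m {n} (f : Fin (m ℕ.+ n) → ℕ) → sumFin f ≡ sumFin (f ∘ (_↑ˡ n)) ℕ.+ sumFin (f ∘ (m ↑ʳ_))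
sumFin-++ zero    f = ≡.refl
sumFin-++ (suc m) f = ≡.trans (≡.cong (f zero ℕ.+_) (sumFin-++ m (f ∘ suc))) (≡.sym (ℕ.+-assoc (f zero) _ _))

-- Each fibre of `quotient` has m elements. This sums a bound that depends only on the copy
-- containing a vertex.
sumFin-quotient : ∀ k m (h : Fin k → ℕ) → sumFin {k ℕ.* m} (h ∘ Fin.quotient {k} m) ≡ m ℕ.* sumFin h
sumFin-quotient zero    m h = ≡.sym (ℕ.*-zeroʳ m)
sumFin-quotient (suc k) m h = begin
  sumFin (h ∘ Fin.quotient {suc k} m)
    ≡⟨ sumFin-++ m _ ⟩
  sumFin (h ∘ Fin.quotient {suc k} m ∘ (_↑ˡ (k ℕ.* m))) ℕ.+ sumFin (h ∘ Fin.quotient {suc k} m ∘ (m ↑ʳ_))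
    ≡⟨ ≡.cong₂ ℕ._+_ (sumFin-cong λ i → ≡.cong h (first i)) (sumFin-cong λ i → ≡.cong h (rest i)) ⟩
  sumFin {m} (λ _ → h zero) ℕ.+ sumFin (h ∘ suc ∘ Fin.quotient {k} m)
    ≡⟨ ≡.cong₂ ℕ._+_ (sumFin-const m (h zero)) (sumFin-quotient k m (h ∘ suc)) ⟩
  m ℕ.* h zero ℕ.+ m ℕ.* sumFin (h ∘ suc)
    ≡⟨ ℕ.*-distribˡ-+ m (h zero) _ ⟨
  m ℕ.* sumFin h ∎
  where
  open ≡.≡-Reasoning
  first : ∀ i → Fin.quotient {suc k} m (i ↑ˡ (k ℕ.* m)) ≡ zero
  first i rewrite Fin.splitAt-↑ˡ m i (k ℕ.* m) = ≡.refl
  rest : ∀ i → Fin.quotient {suc k} m (m ↑ʳ i) ≡ suc (Fin.quotient {k} m i)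
  rest i rewrite Fin.splitAt-↑ʳ m (k ℕ.* m) i = ≡.refl

-- The search inside dist is local and has no name; checking dist-unfold solves the underscore to it.
mutual
  search : ∀ {n} (G : Graph n) (v w : Fin n) (k fuel : ℕ) → ℕ
  search G v w k fuel = _

  dist-unfold : ∀ {n} (G : Graph (suc n)) v w → dist G v w ≡ (if reach G 0 v w then 0 else search G v w 1 n)
  dist-unfold {n} G v w with suc n | G | v | w | 1
  ... | _ | _ | _ | _ | _ = ≡.refl

module Distances {n} (G : Graph n) where

  -- The condition m ≤ k + fuel covers exhaustion: a search that runs out of fuel returns a value
  -- that has already reached m.
  search-≥ : ∀ {m v w} k fuel → m ≤ k ℕ.+ fuel → (∀ i → i < m → ¬ T (reach G i v w)) → m ≤ search G v w k fuel
  search-≥ k zero m≤k unreached = ≡.subst (_ ≤_) (ℕ.+-identityʳ k) m≤k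
  search-≥ {m} {v} {w} k (suc fuel) m≤k+f unreached with reach G k v w in eq
  ... | true  = ℕ.≮⇒≥ λ k<m → unreached k k<m (≡.subst T (≡.sym eq) _)
  ... | false = search-≥ (suc k) fuel (≡.subst (m ≤_) (ℕ.+-suc k fuel) m≤k+f) unreached

  -- `dist` never exceeds n, whence the condition m ≤ n, which every later eccentricity bound
  -- carries along.
  dist-≥ : ∀ {m v w} → m ≤ n → (∀ i → i < m → ¬ T (reach G i v w)) → m ≤ dist G v w
  dist-≥ = search-≥ 0 n

  dist≤ecc : ∀ v w → dist G v w ≤ ecc G v
  dist≤ecc v w = ≤-foldr-⊔ (dist G v) (∈-allFin w)

  sumEcc≡sumFin : sumEcc G ≡ sumFin (ecc G)
  sumEcc≡sumFin = ≡.cong sum (List.map-tabulate id (ecc G))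

  neighbours : Fin n → List (Fin n)
  neighbours v = filter (λ w → T? (adj G v w)) (allFin n)

  deg-≥ : ∀ {d} v (f : Fin d → Fin n) → (∀ {i j} → f i ≡ f j → i ≡ j) → (∀ i → T (adj G v (f i))) → d ≤ deg G v
  deg-≥ v f inj v~f = Fin.injective⇒≤ {f = Any.index ∘ member} λ {i} {j} eq →
    inj (≡.trans (lookup-index (member i)) (≡.trans (≡.cong (List.lookup (neighbours v)) eq) (≡.sym (lookup-index (member j)))))
    where
    member : ∀ i → f i ∈ neighbours v
    member i = ∈-filter⁺ (λ w → T? (adj G v w)) (∈-allFin (f i)) (v~f i)

  deg-≤ : ∀ {d} v (f : Fin d → Fin n) → (∀ w → T (adj G v w) → ∃ λ i → f i ≡ w) → deg G v ≤ d
  deg-≤ v f covers = Fin.injective⇒≤ {f = proj₁ ∘ cover} λ {i} {j} eq →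
    lookup-injective (filter⁺ (λ w → T? (adj G v w)) (allFin⁺ n)) (≡.trans (≡.sym (proj₂ (cover i))) (≡.trans (≡.cong f eq) (proj₂ (cover j))))
    where
    cover : ∀ i → ∃ λ j → f j ≡ List.lookup (neighbours v) i
    cover i = covers _ (proj₂ (∈-filter⁻ (λ w → T? (adj G v w)) {xs = allFin n} (∈-lookup {xs = neighbours v} i)))

module FiniteGraph {n} {V : Set} (enumeration : Fin n ↔ V) (E : V → V → Set) (E? : ∀ u v → Dec (E u v))
  (E-sym : ∀ {u v} → E u v → E v u) (E-irrefl : ∀ {v} → ¬ E v v) where

  open Inverse enumeration using (to; from; strictlyInverseˡ; strictlyInverseʳ)

  isYes-cong : ∀ {A B : Set} (a? : Dec A) (b? : Dec B) → (A → B) → (B → A) → isYes a? ≡ isYes b?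
  isYes-cong (yes a) (yes b) f g = ≡.refl
  isYes-cong (no ¬a) (no ¬b) f g = ≡.refl
  isYes-cong (yes a) (no ¬b) f g = contradiction (f a) ¬b
  isYes-cong (no ¬a) (yes b) f g = contradiction (g b) ¬a

  graph : Graph n
  graph .adj u v = isYes (E? (to u) (to v))
  graph .sym u v = isYes-cong (E? (to u) (to v)) (E? (to v) (to u)) E-sym E-sym
  graph .irrefl v with E? (to v) (to v)
  ... | yes e = contradiction e E-irrefl
  ... | no _  = ≡.refl

  open Distances graph

  adj⇒E : ∀ {u v} → T (adj graph u v) → E (to u) (to v)
  adj⇒E {u} {v} = toWitness {a? = E? (to u) (to v)}

  E⇒adj : ∀ {u v} → E (to u) (to v) → T (adj graph u v)
  E⇒adj {u} {v} = fromWitness {a? = E? (to u) (to v)}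

  E⇒adj-from : ∀ {u v} → E (to u) v → T (adj graph u (from v))
  E⇒adj-from {u} {v} e = E⇒adj {u} (≡.subst (E (to u)) (≡.sym (strictlyInverseˡ v)) e)

  to-injective : ∀ {u v} → to u ≡ to v → u ≡ v
  to-injective {u} {v} eq = ≡.trans (≡.sym (strictlyInverseʳ u)) (≡.trans (≡.cong from eq) (strictlyInverseʳ v))

  from-injective : ∀ {u v} → from u ≡ from v → u ≡ v
  from-injective {u} {v} eq = ≡.trans (≡.sym (strictlyInverseˡ u)) (≡.trans (≡.cong to eq) (strictlyInverseˡ v))

  degree-≥ : ∀ {d} v (f : Fin d → V) → (∀ {i j} → f i ≡ f j → i ≡ j) → (∀ i → E (to v) (f i)) → d ≤ deg graph v
  degree-≥ v f inj v~f = deg-≥ v (from ∘ f) (inj ∘ from-injective) (λ i → E⇒adj-from {v} (v~f i))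

  degree-≤ : ∀ {d} v (f : Fin d → V) → (∀ w → E (to v) w → ∃ λ i → f i ≡ w) → deg graph v ≤ d
  degree-≤ v f covers = deg-≤ v (from ∘ f) λ w v~w → let i , eq = covers (to w) (adj⇒E {v} {w} v~w) in
    i , ≡.trans (≡.cong from eq) (strictlyInverseʳ w)

  bipartite : (c : V → Bool) → (∀ {u v} → E u v → c u ≢ c v) → Bipartite graph
  bipartite c proper = c ∘ to , λ u v u~v → proper (adj⇒E {u} {v} (≡true⇒T u~v))

  c4Free : (∀ {a b c d} → a ≢ c → b ≢ d → E a b → E b c → E c d → E d a → ⊥) → C4Free graph
  c4Free no-C4 (a , b , c , d , _ , a≢c , _ , _ , b≢d , _ , ab , bc , cd , da) =
    no-C4 (a≢c ∘ to-injective) (b≢d ∘ to-injective) (edge a b ab) (edge b c bc) (edge c d cd) (edge d a da)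
    where
    edge : ∀ u v → adj graph u v ≡ true → E (to u) (to v)
    edge u v = adj⇒E {u} {v} ∘ ≡true⇒T

  reach-refl : ∀ v → T (reach graph 0 v v)
  reach-refl v = fromWitness {a? = v Fin.≟ v} ≡.refl

  reach-step : ∀ k {u v w} → T (reach graph k u v) → T (adj graph v w) → T (reach graph (suc k) u w)
  reach-step k {u} {v} {w} u~v v~w = Equivalence.from T-∨ (inj₂ (any⁺ (λ x → reach graph k u x ∧ adj graph x w)
    (Any.map (λ { ≡.refl → Equivalence.from T-∧ (u~v , v~w) }) (∈-allFin v))))

  Star⇒reach : ∀ k {u v w} → T (reach graph k u (from v)) → Star E v w → ∃ λ k → T (reach graph k u (from w))
  Star⇒reach k u~v ε = k , u~v
  Star⇒reach k {u} {v} u~v (_◅_ {j = x} e path) = Star⇒reach (suc k) {u} {x} (reach-step k {u} {from v} u~v v~x) path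
    where
    v~x : T (adj graph (from v) (from x))
    v~x = E⇒adj-from {from v} (≡.subst (λ y → E y x) (≡.sym (strictlyInverseˡ v)) e)

  connected : (∀ u v → Star E u v) → Connected graph
  connected path u v = let k , u~v = Star⇒reach 0 {u} {to u} (≡.subst (T ∘ reach graph 0 u) (≡.sym (strictlyInverseʳ u)) (reach-refl u)) (path (to u) (to v)) in
    k , T⇒≡true (≡.subst (T ∘ reach graph k u) (strictlyInverseʳ v) u~v)

  module _ (φ : V → ℕ) (lipschitz : ∀ {u v} → E u v → φ v ≤ suc (φ u)) where

    reach-lipschitz : ∀ k {u v} → T (reach graph k u v) → φ (to v) ≤ k ℕ.+ φ (to u)
    reach-lipschitz zero {u} {v} u≡v with toWitness {a? = u Fin.≟ v} u≡v
    ... | ≡.refl = ℕ.≤-refl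
    reach-lipschitz (suc k) {u} {v} r with Equivalence.to T-∨ r
    ... | inj₁ r′ = ℕ.m≤n⇒m≤1+n (reach-lipschitz k {u} {v} r′)
    ... | inj₂ r′ = step (Any.satisfied (any⁻ (λ x → reach graph k u x ∧ adj graph x v) (allFin n) r′))
      where
      step : (∃ λ x → T (reach graph k u x ∧ adj graph x v)) → φ (to v) ≤ suc (k ℕ.+ φ (to u))
      step (x , h) = let u~x , x~v = Equivalence.to T-∧ h in
        ℕ.≤-trans (lipschitz (adj⇒E {x} {v} x~v)) (s≤s (reach-lipschitz k {u} {x} u~x))

    ecc-≥ : ∀ {m} v w → m ≤ n → m ℕ.+ φ (to v) ≤ φ w → m ≤ ecc graph v
    ecc-≥ {m} v w m≤n far = ℕ.≤-trans (dist-≥ {v = v} {from w} m≤n unreached) (dist≤ecc v (from w))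
      where
      unreached : ∀ i → i < m → ¬ T (reach graph i v (from w))
      unreached i i<m r = ℕ.<⇒≱ (ℕ.+-monoˡ-< (φ (to v)) i<m)
        (ℕ.≤-trans far (≡.subst (λ x → φ x ≤ i ℕ.+ φ (to v)) (strictlyInverseˡ w) (reach-lipschitz i {v} {from w} r)))

  -- The potential is turned upside down to φ(v) ∸ φ(x). Truncation keeps it 1-Lipschitz, and
  -- symmetry of the edges supplies the reversed inequality.
  ecc-≥-descending : (φ : V → ℕ) → (∀ {u v} → E u v → φ v ≤ suc (φ u)) →
    ∀ {m} v w → m ≤ n → m ℕ.+ φ w ≤ φ (to v) → m ≤ ecc graph v
  ecc-≥-descending φ lipschitz {m} v w m≤n far = ecc-≥ (λ x → φ (to v) ∸ φ x) lipschitz′ v w m≤n (begin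
    m ℕ.+ (φ (to v) ∸ φ (to v))    ≡⟨ ≡.cong (m ℕ.+_) (ℕ.n∸n≡0 (φ (to v))) ⟩
    m ℕ.+ 0                        ≡⟨ ℕ.+-identityʳ m ⟩
    m                              ≡⟨ ℕ.m+n∸n≡m m (φ w) ⟨
    m ℕ.+ φ w ∸ φ w                ≤⟨ ℕ.∸-monoˡ-≤ (φ w) far ⟩
    φ (to v) ∸ φ w                 ∎)
    where
    open ℕ.≤-Reasoning
    m∸n≤1+[m∸[1+n]] : ∀ m n → m ∸ n ≤ suc (m ∸ suc n)
    m∸n≤1+[m∸[1+n]] zero    n       = ℕ.≤-trans (ℕ.m∸n≤m 0 n) z≤n
    m∸n≤1+[m∸[1+n]] (suc m) zero    = ℕ.≤-refl
    m∸n≤1+[m∸[1+n]] (suc m) (suc n) = m∸n≤1+[m∸[1+n]] m n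
    lipschitz′ : ∀ {x y} → E x y → φ (to v) ∸ φ y ≤ suc (φ (to v) ∸ φ x)
    lipschitz′ {x} {y} e = ℕ.≤-trans (m∸n≤1+[m∸[1+n]] (φ (to v)) (φ y)) (s≤s (ℕ.∸-monoʳ-≤ (φ (to v)) (lipschitz (E-sym e))))

-- The chain of projective planes

-- The points of a projective plane of order q: affine points (x , y), directions of slope m, and
-- the direction of the vertical lines.  The lines are coded dually: slope and intercept, verticals by their
-- abscissa, and the line at infinity.
data Elem (q : ℕ) : Set where
  affine    : (x y : Fin q) → Elem q
  direction : (m : Fin q) → Elem q
  infinity  : Elem q

-- Bracketed to match the decomposition of `Fin` in `elemEnumeration`.
planeOrder : ℕ → ℕ
planeOrder q = q * q + (q + 1)

elemEnumeration : ∀ {q} → Fin (planeOrder q) ↔ Elem q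
elemEnumeration {q} = ↔-trans Fin.+↔⊎ (↔-trans (Fin.*↔× ⊎-↔ ↔-trans Fin.+↔⊎ (↔-refl ⊎-↔ Fin.1↔⊤)) (mk↔ₛ′ fold unfold fold-unfold unfold-fold))
  where
  Code : Set
  Code = (Fin q × Fin q) ⊎ (Fin q ⊎ ⊤)
  fold : Code → Elem q
  fold (inj₁ (x , y)) = affine x y
  fold (inj₂ (inj₁ m)) = direction m
  fold (inj₂ (inj₂ tt)) = infinity
  unfold : Elem q → Code
  unfold (affine x y) = inj₁ (x , y)
  unfold (direction m) = inj₂ (inj₁ m)
  unfold infinity = inj₂ (inj₂ tt)
  fold-unfold : ∀ e → fold (unfold e) ≡ e
  fold-unfold (affine x y) = ≡.refl
  fold-unfold (direction m) = ≡.refl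
  fold-unfold infinity = ≡.refl
  unfold-fold : ∀ c → unfold (fold c) ≡ c
  unfold-fold (inj₁ (x , y)) = ≡.refl
  unfold-fold (inj₂ (inj₁ m)) = ≡.refl
  unfold-fold (inj₂ (inj₂ tt)) = ≡.refl

module Chain {q₁} (plane : TernaryRing (suc q₁)) (j₁ : ℕ) where
  open TernaryRing plane

  private
    q = suc q₁
    j = suc j₁
    -- An even number of copies allows the two halves to be paired, and j ≥ 1 keeps the first copy
    -- distinct from the last.
    k = j + j
    blockSize = planeOrder q + planeOrder q

  -- Copies of the plane are joined by an edge from each line at infinity to the vertical direction of the next
  -- copy, and only the first and the last copy retain the edge between their own two elements at infinity.
  Link : Fin k → Fin k → Set
  Link i j = toℕ i ≡ suc (toℕ j) ⊎ (i ≡ j × (toℕ i ≡ 0 ⊎ suc (toℕ i) ≡ k))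

  link? : ∀ i j → Dec (Link i j)
  link? i j = (toℕ i ℕ.≟ suc (toℕ j)) ⊎-dec ((i Fin.≟ j) ×-dec ((toℕ i ℕ.≟ 0) ⊎-dec (suc (toℕ i) ℕ.≟ k)))

  data Incident : Fin k → Elem q → Fin k → Elem q → Set where
    on-line     : ∀ {i x y m b} → value m x b ≡ y → Incident i (affine x y) i (affine m b)
    on-vertical : ∀ {i x y} → Incident i (affine x y) i (direction x)
    slope       : ∀ {i m b} → Incident i (direction m) i (affine m b)
    horizon     : ∀ {i m} → Incident i (direction m) i infinity
    vertical∞   : ∀ {i x} → Incident i infinity i (direction x)
    linked      : ∀ {i j} → Link i j → Incident i infinity j infinity

  incident? : ∀ i p j l → Dec (Incident i p j l)
  incident? i (affine x y) j (affine m b) = map′ (λ { (≡.refl , eq) → on-line eq }) (λ { (on-line eq) → ≡.refl , eq }) ((i Fin.≟ j) ×-dec (value m x b Fin.≟ y))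
  incident? i (affine x y) j (direction x′) = map′ (λ { (≡.refl , ≡.refl) → on-vertical }) (λ { on-vertical → ≡.refl , ≡.refl }) ((i Fin.≟ j) ×-dec (x Fin.≟ x′))
  incident? i (affine x y) j infinity = no λ ()
  incident? i (direction m) j (affine m′ b) = map′ (λ { (≡.refl , ≡.refl) → slope }) (λ { slope → ≡.refl , ≡.refl }) ((i Fin.≟ j) ×-dec (m Fin.≟ m′))
  incident? i (direction m) j (direction x) = no λ ()
  incident? i (direction m) j infinity = map′ (λ { ≡.refl → horizon }) (λ { horizon → ≡.refl }) (i Fin.≟ j)
  incident? i infinity j (affine m b) = no λ ()
  incident? i infinity j (direction x) = map′ (λ { ≡.refl → vertical∞ }) (λ { vertical∞ → ≡.refl }) (i Fin.≟ j)
  incident? i infinity j infinity = map′ linked (λ { (linked h) → h }) (link? i j)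

  -- A copy with both a predecessor and a retained edge is the last one. Nothing follows it, so its
  -- line at infinity meets no other point at infinity.
  bent : ∀ {i i′ j : Fin k} → i ≢ i′ → toℕ i ≡ suc (toℕ j) → toℕ i ≡ 0 ⊎ suc (toℕ i) ≡ k → ¬ Link i′ i
  bent i≢i′ i≡1+j (inj₁ i≡0) l = contradiction (≡.trans (≡.sym i≡0) i≡1+j) λ ()
  bent {i′ = i′} i≢i′ i≡1+j (inj₂ last) (inj₁ i′≡1+i) = contradiction (Fin.toℕ<n i′) (ℕ.≤⇒≯ (ℕ.≤-reflexive (≡.sym (≡.trans i′≡1+i last))))
  bent i≢i′ i≡1+j (inj₂ last) (inj₂ (i′≡i , _)) = i≢i′ (≡.sym i′≡i)

  links-C4Free : ∀ {i i′ j j′} → i ≢ i′ → j ≢ j′ → Link i j → Link i j′ → Link i′ j → Link i′ j′ → ⊥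
  links-C4Free i≢i′ j≢j′ (inj₁ a) (inj₁ b) _ _ = j≢j′ (Fin.toℕ-injective (ℕ.suc-injective (≡.trans (≡.sym a) b)))
  links-C4Free i≢i′ j≢j′ (inj₂ (a , _)) (inj₂ (b , _)) _ _ = j≢j′ (≡.trans (≡.sym a) b)
  links-C4Free i≢i′ j≢j′ (inj₁ a) (inj₂ (≡.refl , end)) _ l = bent i≢i′ a end l
  links-C4Free i≢i′ j≢j′ (inj₂ (≡.refl , end)) (inj₁ b) l _ = bent i≢i′ b end l

  Vertex : Set
  Vertex = Fin k × (Elem q ⊎ Elem q)

  pattern point i p = i , inj₁ p
  pattern line  i l = i , inj₂ l

  -- Four affine incidences are the case that needs `two-meets`: equal slopes then force equal
  -- intercepts, and equal abscissae force equal ordinates. Vertical and infinite elements are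
  -- settled by their single coordinate, links by `links-C4Free`.
  incidence-C4Free : ∀ {i p i′ p′ j l j′ l′} → ¬ (i ≡ i′ × p ≡ p′) → ¬ (j ≡ j′ × l ≡ l′) →
    Incident i p j l → Incident i p j′ l′ → Incident i′ p′ j l → Incident i′ p′ j′ l′ → ⊥
  incidence-C4Free p≢p′ l≢l′ (on-line a) (on-line b) (on-line c) (on-line d)
    with two-meets (≡.trans a (≡.sym b)) (≡.trans c (≡.sym d))
  ... | inj₁ ≡.refl = l≢l′ (≡.refl , ≡.cong (affine _) (value-injective (≡.trans a (≡.sym b))))
  ... | inj₂ ≡.refl = p≢p′ (≡.refl , ≡.cong (affine _) (≡.trans (≡.sym a) c))
  incidence-C4Free p≢p′ l≢l′ (on-line a) (on-line b) slope slope =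
    l≢l′ (≡.refl , ≡.cong (affine _) (value-injective (≡.trans a (≡.sym b))))
  incidence-C4Free p≢p′ l≢l′ (on-line a) on-vertical (on-line c) on-vertical = p≢p′ (≡.refl , ≡.cong (affine _) (≡.trans (≡.sym a) c))
  incidence-C4Free p≢p′ l≢l′ on-vertical (on-line a) on-vertical (on-line c) = p≢p′ (≡.refl , ≡.cong (affine _) (≡.trans (≡.sym a) c))
  incidence-C4Free p≢p′ l≢l′ on-vertical on-vertical _ _ = l≢l′ (≡.refl , ≡.refl)
  incidence-C4Free p≢p′ l≢l′ slope slope (on-line a) (on-line b) = l≢l′ (≡.refl , ≡.cong (affine _) (value-injective (≡.trans a (≡.sym b))))
  incidence-C4Free p≢p′ l≢l′ slope _ slope _ = p≢p′ (≡.refl , ≡.refl)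
  incidence-C4Free p≢p′ l≢l′ slope horizon (on-line a) ()
  incidence-C4Free p≢p′ l≢l′ horizon slope horizon slope = p≢p′ (≡.refl , ≡.refl)
  incidence-C4Free p≢p′ l≢l′ horizon slope (linked _) ()
  incidence-C4Free p≢p′ l≢l′ horizon horizon _ _ = l≢l′ (≡.refl , ≡.refl)
  incidence-C4Free p≢p′ l≢l′ vertical∞ _ vertical∞ _ = p≢p′ (≡.refl , ≡.refl)
  incidence-C4Free p≢p′ l≢l′ vertical∞ vertical∞ on-vertical on-vertical = l≢l′ (≡.refl , ≡.refl)
  incidence-C4Free p≢p′ l≢l′ vertical∞ (linked _) on-vertical ()
  incidence-C4Free p≢p′ l≢l′ (linked _) vertical∞ horizon ()
  incidence-C4Free p≢p′ l≢l′ (linked _) vertical∞ (linked _) vertical∞ = p≢p′ (≡.refl , ≡.refl)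
  incidence-C4Free p≢p′ l≢l′ (linked _) (linked _) horizon horizon = l≢l′ (≡.refl , ≡.refl)
  incidence-C4Free p≢p′ l≢l′ (linked a) (linked b) (linked c) (linked d) =
    links-C4Free (λ i≡i′ → p≢p′ (i≡i′ , ≡.refl)) (λ j≡j′ → l≢l′ (j≡j′ , ≡.refl)) a b c d

  data Edge : Vertex → Vertex → Set where
    up   : ∀ {i p j l} → Incident i p j l → Edge (point i p) (line j l)
    down : ∀ {i p j l} → Incident i p j l → Edge (line j l) (point i p)

  edge? : ∀ u v → Dec (Edge u v)
  edge? (point i p) (point j l) = no λ ()
  edge? (point i p) (line j l)  = map′ up (λ { (up h) → h }) (incident? i p j l)
  edge? (line j l)  (point i p) = map′ down (λ { (down h) → h }) (incident? i p j l)
  edge? (line j l)  (line i p)  = no λ ()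

  edge-sym : ∀ {u v} → Edge u v → Edge v u
  edge-sym (up h)   = down h
  edge-sym (down h) = up h

  edge-irrefl : ∀ {v} → ¬ Edge v v
  edge-irrefl ()

  edge-C4Free : ∀ {a b c d} → a ≢ c → b ≢ d → Edge a b → Edge b c → Edge c d → Edge d a → ⊥
  edge-C4Free a≢c b≢d (up ab) (down cb) (up cd) (down ad) =
    incidence-C4Free (λ { (≡.refl , ≡.refl) → a≢c ≡.refl }) (λ { (≡.refl , ≡.refl) → b≢d ≡.refl }) ab ad cb cd
  edge-C4Free a≢c b≢d (down ba) (up bc) (down dc) (up da) =
    incidence-C4Free (λ { (≡.refl , ≡.refl) → b≢d ≡.refl }) (λ { (≡.refl , ≡.refl) → a≢c ≡.refl }) ba bc da dc

  link-left : ∀ i → ∃ λ j → Link i j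
  link-left zero    = zero , inj₂ (≡.refl , inj₁ ≡.refl)
  link-left (suc i) = inject₁ i , inj₁ (≡.cong suc (≡.sym (Fin.toℕ-inject₁ i)))

  link-right : ∀ j → ∃ λ i → Link i j
  link-right j with suc (toℕ j) ℕ.<? k
  ... | yes 1+j<k = Fin.fromℕ< 1+j<k , inj₁ (Fin.toℕ-fromℕ< 1+j<k)
  ... | no 1+j≮k = j , inj₂ (≡.refl , inj₂ (ℕ.≤-antisym (Fin.toℕ<n j) (ℕ.≮⇒≥ 1+j≮k)))

  -- Only q + 1 neighbours are listed: the line at infinity of the first copy and the point at
  -- infinity of the last have one more, having both a retained edge and a link.
  neighbour : Vertex → Fin (suc q) → Vertex
  neighbour (point i (affine x y))  zero    = line i (direction x)
  neighbour (point i (affine x y))  (suc m) = line i (affine m (intercept m x y))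
  neighbour (point i (direction m)) zero    = line i infinity
  neighbour (point i (direction m)) (suc b) = line i (affine m b)
  neighbour (point i infinity)      zero    = line (proj₁ (link-left i)) infinity
  neighbour (point i infinity)      (suc x) = line i (direction x)
  neighbour (line j (affine m b))   zero    = point j (direction m)
  neighbour (line j (affine m b))   (suc x) = point j (affine x (value m x b))
  neighbour (line j (direction x))  zero    = point j infinity
  neighbour (line j (direction x))  (suc y) = point j (affine x y)
  neighbour (line j infinity)       zero    = point (proj₁ (link-right j)) infinity
  neighbour (line j infinity)       (suc m) = point j (direction m)

  neighbour-edge : ∀ v c → Edge v (neighbour v c)
  neighbour-edge (point i (affine x y))  zero    = up on-vertical
  neighbour-edge (point i (affine x y))  (suc m) = up (on-line (value-intercept m x y))
  neighbour-edge (point i (direction m)) zero    = up horizon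
  neighbour-edge (point i (direction m)) (suc b) = up slope
  neighbour-edge (point i infinity)      zero    = up (linked (proj₂ (link-left i)))
  neighbour-edge (point i infinity)      (suc x) = up vertical∞
  neighbour-edge (line j (affine m b))   zero    = down slope
  neighbour-edge (line j (affine m b))   (suc x) = down (on-line ≡.refl)
  neighbour-edge (line j (direction x))  zero    = down vertical∞
  neighbour-edge (line j (direction x))  (suc y) = down on-vertical
  neighbour-edge (line j infinity)       zero    = down (linked (proj₂ (link-right j)))
  neighbour-edge (line j infinity)       (suc m) = down horizon

  neighbour-injective : ∀ v {c d} → neighbour v c ≡ neighbour v d → c ≡ d
  neighbour-injective v {zero} {zero} eq = ≡.refl
  neighbour-injective (point i (affine x y))  {suc m} {suc .m} ≡.refl = ≡.refl
  neighbour-injective (point i (direction m)) {suc b} {suc .b} ≡.refl = ≡.refl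
  neighbour-injective (point i infinity)      {suc x} {suc .x} ≡.refl = ≡.refl
  neighbour-injective (line j (affine m b))   {suc x} {suc .x} ≡.refl = ≡.refl
  neighbour-injective (line j (direction x))  {suc y} {suc .y} ≡.refl = ≡.refl
  neighbour-injective (line j infinity)       {suc m} {suc .m} ≡.refl = ≡.refl
  neighbour-injective (point i (affine x y))  {zero} {suc m} ()
  neighbour-injective (point i (direction m)) {zero} {suc b} ()
  neighbour-injective (point i infinity)      {zero} {suc x} ()
  neighbour-injective (line j (affine m b))   {zero} {suc x} ()
  neighbour-injective (line j (direction x))  {zero} {suc y} ()
  neighbour-injective (line j infinity)       {zero} {suc m} ()
  neighbour-injective (point i (affine x y))  {suc m} {zero} ()
  neighbour-injective (point i (direction m)) {suc b} {zero} ()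
  neighbour-injective (point i infinity)      {suc x} {zero} ()
  neighbour-injective (line j (affine m b))   {suc x} {zero} ()
  neighbour-injective (line j (direction x))  {suc y} {zero} ()
  neighbour-injective (line j infinity)       {suc m} {zero} ()

  direction-neighbours : ∀ i m w → Edge (point i (direction m)) w → ∃ λ c → neighbour (point i (direction m)) c ≡ w
  direction-neighbours i m _ (up slope)   = suc _ , ≡.refl
  direction-neighbours i m _ (up horizon) = zero , ≡.refl

  -- Connectivity of the chain

  Path : Vertex → Vertex → Set
  Path = Star Edge

  to-infinity : ∀ i e → Path (i , e) (point i infinity)
  to-infinity i (inj₂ (direction x)) = down vertical∞ ◅ ε
  to-infinity i (inj₁ (affine x y))  = up on-vertical ◅ to-infinity i (inj₂ (direction x))
  to-infinity i (inj₂ (affine m b))  = down (on-line {x = zero} ≡.refl) ◅ up on-vertical ◅ down vertical∞ ◅ ε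
  to-infinity i (inj₁ (direction m)) = up (slope {b = zero}) ◅ down (on-line {x = zero} ≡.refl) ◅ up on-vertical ◅ down vertical∞ ◅ ε
  to-infinity i (inj₁ infinity)      = ε
  to-infinity i (inj₂ infinity)      = down (horizon {m = zero}) ◅ to-infinity i (inj₁ (direction zero))

  to-root : ∀ i → Path (point i infinity) (point zero infinity)
  to-root = <-weakInduction _ ε λ i path →
    up (linked (proj₂ (link-left (suc i)))) ◅ (to-infinity (inject₁ i) (inj₂ infinity) ◅◅ path)

  path : ∀ u v → Path u v
  path (i , e) (i′ , e′) = (to-infinity i e ◅◅ to-root i) ◅◅ reverse edge-sym (to-infinity i′ e′ ◅◅ to-root i′)

  -- Levels within a copy are distances from its point at infinity after deletion of the edge between its two
  -- elements at infinity.  Where that edge is retained, they are bent so that the copy remains 1-Lipschitz.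
  level : Bool → Bool → Elem q ⊎ Elem q → ℕ
  level first last (inj₁ infinity)      = if first then 4 else 0
  level first last (inj₂ (direction _)) = if first then 3 else 1
  level first last (inj₁ (affine _ _))  = 2
  level first last (inj₂ (affine _ _))  = 3
  level first last (inj₁ (direction _)) = if last then 2 else 4
  level first last (inj₂ infinity)      = if last then 1 else 5

  first? : (i : Fin k) → Dec (toℕ i ≡ 0)
  first? i = toℕ i ℕ.≟ 0

  last? : (i : Fin k) → Dec (suc (toℕ i) ≡ k)
  last? i = suc (toℕ i) ℕ.≟ k

  -- An inner copy climbs from level 0 to level 5 and the joining edge adds one, hence the factor 6.
  potential : Vertex → ℕ
  potential (i , e) = 6 * toℕ i + level (isYes (first? i)) (isYes (last? i)) e

  Near : ℕ → ℕ → Set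
  Near a b = a ≤ suc b × b ≤ suc a

  n-near-1+n : ∀ n → Near n (suc n)
  n-near-1+n n = ℕ.m≤n⇒m≤1+n (ℕ.n≤1+n n) , ℕ.≤-refl

  near-sym : ∀ {a b} → Near a b → Near b a
  near-sym (a≤b , b≤a) = b≤a , a≤b

  near-+ : ∀ c {a b} → Near a b → Near (c + a) (c + b)
  near-+ c (a≤b , b≤a) = shift a≤b , shift b≤a
    where
    shift : ∀ {a b} → a ≤ suc b → c + a ≤ suc (c + b)
    shift {a} {b} a≤1+b = ≡.subst (c + a ≤_) (ℕ.+-suc c b) (ℕ.+-monoʳ-≤ c a≤1+b)

  end-levels-near : ∀ {i : Fin k} (f : Dec (toℕ i ≡ 0)) (l : Dec (suc (toℕ i) ≡ k)) → toℕ i ≡ 0 ⊎ suc (toℕ i) ≡ k →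
    Near (level (isYes f) (isYes l) (inj₁ infinity)) (level (isYes f) (isYes l) (inj₂ infinity))
  -- There are at least two copies, so no copy is both first and last.
  end-levels-near (yes i≡0) (yes 1+i≡k) _ = contradiction
    (ℕ.suc-injective (≡.trans (≡.cong suc (≡.sym i≡0)) 1+i≡k)) λ 0≡ → contradiction (≡.trans 0≡ (ℕ.+-suc j₁ j₁)) λ ()
  end-levels-near (yes _)   (no _)    _          = n-near-1+n 4
  end-levels-near (no _)    (yes _)   _          = n-near-1+n 0
  end-levels-near (no i≢0)  (no _)    (inj₁ i≡0) = contradiction i≡0 i≢0
  end-levels-near (no _)    (no 1+i≢) (inj₂ 1+i) = contradiction 1+i 1+i≢

  -- Since i comes after i′, copy i is not the first and i′ is not the last; the two levels at the
  -- joint are the unbent 0 and 5.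
  joint-near : ∀ {i i′ : Fin k} (f : Dec (toℕ i ≡ 0)) {l} {f′} (l′ : Dec (suc (toℕ i′) ≡ k)) → toℕ i ≡ suc (toℕ i′) →
    Near (6 * toℕ i + level (isYes f) l (inj₁ infinity)) (6 * toℕ i′ + level f′ (isYes l′) (inj₂ infinity))
  joint-near (yes i≡0) _ i≡1+i′ = contradiction (≡.trans (≡.sym i≡0) i≡1+i′) λ ()
  joint-near {i} (no _) (yes 1+i′≡k) i≡1+i′ = contradiction (Fin.toℕ<n i) (ℕ.≤⇒≯ (ℕ.≤-reflexive (≡.sym (≡.trans i≡1+i′ 1+i′≡k))))
  joint-near {i} {i′} (no _) (no _) i≡1+i′ = ≡.subst (λ a → Near a (6 * toℕ i′ + 5)) (≡.sym eq) (near-sym (n-near-1+n (6 * toℕ i′ + 5)))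
    where
    open ℕ-Solver.+-*-Solver
    eq : 6 * toℕ i + 0 ≡ suc (6 * toℕ i′ + 5)
    eq = ≡.trans (≡.cong (λ a → 6 * a + 0) i≡1+i′) (solve 1 (λ a → con 6 :* (con 1 :+ a) :+ con 0 := con 1 :+ (con 6 :* a :+ con 5)) ≡.refl (toℕ i′))

  incident-near : ∀ {i p i′ l} → Incident i p i′ l → Near (potential (point i p)) (potential (line i′ l))
  incident-near (on-line {i} _) = near-+ (6 * toℕ i) (n-near-1+n 2)
  incident-near (on-vertical {i}) = near-+ (6 * toℕ i) (near (isYes (first? i)))
    where
    near : ∀ f → Near 2 (if f then 3 else 1)
    near false = near-sym (n-near-1+n 1)
    near true  = n-near-1+n 2
  incident-near (slope {i}) = near-+ (6 * toℕ i) (near (isYes (last? i)))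
    where
    near : ∀ l → Near (if l then 2 else 4) 3
    near false = near-sym (n-near-1+n 3)
    near true  = n-near-1+n 2
  incident-near (horizon {i}) = near-+ (6 * toℕ i) (near (isYes (last? i)))
    where
    near : ∀ l → Near (if l then 2 else 4) (if l then 1 else 5)
    near false = n-near-1+n 4
    near true  = near-sym (n-near-1+n 1)
  incident-near (vertical∞ {i}) = near-+ (6 * toℕ i) (near (isYes (first? i)))
    where
    near : ∀ f → Near (if f then 4 else 0) (if f then 3 else 1)
    near false = n-near-1+n 0
    near true  = near-sym (n-near-1+n 3)
  incident-near (linked {i} {i′} (inj₁ i≡1+i′)) = joint-near {i} {i′} (first? i) {isYes (last? i)} {isYes (first? i′)} (last? i′) i≡1+i′
  incident-near (linked {i} (inj₂ (≡.refl , end))) = near-+ (6 * toℕ i) (end-levels-near {i} (first? i) (last? i) end)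

  potential-lipschitz : ∀ {u v} → Edge u v → potential v ≤ suc (potential u)
  potential-lipschitz (up h)   = proj₂ (incident-near h)
  potential-lipschitz (down h) = proj₁ (incident-near h)

  level≤5 : ∀ f l e → level f l e ≤ 5
  level≤5 false l     (inj₁ infinity)      = z≤n
  level≤5 true  l     (inj₁ infinity)      = ℕ.n≤1+n 4
  level≤5 false l     (inj₂ (direction _)) = s≤s z≤n
  level≤5 true  l     (inj₂ (direction _)) = ℕ.m≤m+n 3 2
  level≤5 f     l     (inj₁ (affine _ _))  = ℕ.m≤m+n 2 3
  level≤5 f     l     (inj₂ (affine _ _))  = ℕ.m≤m+n 3 2
  level≤5 f     false (inj₁ (direction _)) = ℕ.n≤1+n 4
  level≤5 f     true  (inj₁ (direction _)) = ℕ.m≤m+n 2 3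
  level≤5 f     false (inj₂ infinity)      = ℕ.≤-refl
  level≤5 f     true  (inj₂ infinity)      = s≤s z≤n

  vertices : Fin (k * blockSize) ↔ Vertex
  vertices = ↔-trans Fin.*↔× (↔-refl ×-↔ ↔-trans Fin.+↔⊎ (elemEnumeration ⊎-↔ elemEnumeration))

  open FiniteGraph vertices Edge edge? edge-sym edge-irrefl public

  block : Fin (k * blockSize) → Fin k
  block = Fin.quotient {k} blockSize

  -- The minimum is attained at a direction: it is incident with no link, so its listed neighbours
  -- are all of them.
  minDegree : MinDegree graph (suc q)
  minDegree = at-least , v₀ , ℕ.≤-antisym (degree-≤ v₀ (neighbour (point zero (direction zero))) covers) (at-least v₀)
    where
    at-least : ∀ v → suc q ≤ deg graph v
    at-least v = degree-≥ v (neighbour (Inverse.to vertices v)) (neighbour-injective (Inverse.to vertices v)) (neighbour-edge (Inverse.to vertices v))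
    v₀ : Fin (k * blockSize)
    v₀ = Inverse.from vertices (point zero (direction zero))
    covers : ∀ w → Edge (Inverse.to vertices v₀) w → ∃ λ c → neighbour (point zero (direction zero)) c ≡ w
    covers w e = direction-neighbours zero zero w (≡.subst (λ u → Edge u w) (Inverse.strictlyInverseˡ vertices _) e)

  side : Vertex → Bool
  side (point _ _) = true
  side (line _ _)  = false

  side-proper : ∀ {u v} → Edge u v → side u ≢ side v
  side-proper (up _) ()
  side-proper (down _) ()

  -- Eccentricities of the chain and their sum

  private
    n = k * blockSize
    -- The largest potential in the last copy, attained at its affine lines because the levels there
    -- are bent.
    top = 6 * (j₁ + j) + 3

  -- Keeps the potential differences within n, the cap on `dist`.
  6k≤n : 6 * k ≤ n
  6k≤n = ≡.subst (_≤ n) (ℕ.*-comm k 6) (ℕ.*-monoʳ-≤ k 6≤blockSize)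
    where
    3≤planeOrder : 3 ≤ planeOrder q
    3≤planeOrder = ℕ.+-mono-≤ {1} (s≤s z≤n) (ℕ.+-monoˡ-≤ 1 (s≤s z≤n))
    6≤blockSize : 6 ≤ blockSize
    6≤blockSize = ℕ.+-mono-≤ 3≤planeOrder 3≤planeOrder

  -- The two ends as seen from copy i, whose potentials lie between 6i and 6i + 5: an affine line of
  -- the last copy has potential `top`, and an affine point of the first has 2, the least there.
  eccBound : Fin k → ℕ
  eccBound i = (top ∸ (6 * toℕ i + 5)) ⊔ (6 * toℕ i ∸ 2)

  ecc-≥-last : ∀ v → top ∸ (6 * toℕ (block v) + 5) ≤ ecc graph v
  ecc-≥-last v with ℕ.≤-total (6 * toℕ (block v) + 5) top
  ... | inj₂ top≤ = ≡.subst (_≤ ecc graph v) (≡.sym (ℕ.m≤n⇒m∸n≡0 top≤)) z≤n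
  ... | inj₁ ≤top = ecc-≥ potential potential-lipschitz v (line (Fin.fromℕ (j₁ + j)) (affine zero zero)) small far
    where
    open ℕ.≤-Reasoning
    i = block v
    small : top ∸ (6 * toℕ i + 5) ≤ n
    small = begin
      top ∸ (6 * toℕ i + 5)  ≤⟨ ℕ.m∸n≤m top (6 * toℕ i + 5) ⟩
      6 * (j₁ + j) + 3       ≤⟨ ℕ.+-monoʳ-≤ (6 * (j₁ + j)) (ℕ.m≤m+n 3 3) ⟩
      6 * (j₁ + j) + 6       ≡⟨ ≡.trans (ℕ.+-comm _ 6) (≡.sym (ℕ.*-suc 6 (j₁ + j))) ⟩
      6 * k                  ≤⟨ 6k≤n ⟩
      n                      ∎
    far : top ∸ (6 * toℕ i + 5) + potential (Inverse.to vertices v) ≤ potential (line (Fin.fromℕ (j₁ + j)) (affine zero zero))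
    far = begin
      top ∸ (6 * toℕ i + 5) + potential (Inverse.to vertices v)
        ≤⟨ ℕ.+-monoʳ-≤ (top ∸ (6 * toℕ i + 5)) (ℕ.+-monoʳ-≤ (6 * toℕ i) (level≤5 _ _ (proj₂ (Inverse.to vertices v)))) ⟩
      top ∸ (6 * toℕ i + 5) + (6 * toℕ i + 5)                    ≡⟨ ℕ.m∸n+n≡m ≤top ⟩
      6 * (j₁ + j) + 3                                           ≡⟨ ≡.cong (λ a → 6 * a + 3) (Fin.toℕ-fromℕ (j₁ + j)) ⟨
      6 * toℕ (Fin.fromℕ (j₁ + j)) + 3                           ∎

  ecc-≥-first : ∀ v → 6 * toℕ (block v) ∸ 2 ≤ ecc graph v
  ecc-≥-first v with ℕ.≤-total 2 (6 * toℕ (block v))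
  ... | inj₂ ≤2 = ≡.subst (_≤ ecc graph v) (≡.sym (ℕ.m≤n⇒m∸n≡0 ≤2)) z≤n
  ... | inj₁ 2≤ = ecc-≥-descending potential potential-lipschitz v (point zero (affine zero zero)) small far
    where
    open ℕ.≤-Reasoning
    i = block v
    small : 6 * toℕ i ∸ 2 ≤ n
    small = ℕ.≤-trans (ℕ.m∸n≤m _ 2) (ℕ.≤-trans (ℕ.*-monoʳ-≤ 6 (ℕ.<⇒≤ (Fin.toℕ<n i))) 6k≤n)
    far : 6 * toℕ i ∸ 2 + 2 ≤ potential (Inverse.to vertices v)
    far = ℕ.≤-trans (ℕ.≤-reflexive (ℕ.m∸n+n≡m 2≤)) (ℕ.m≤m+n _ _)

  eccBound≤ecc : ∀ v → eccBound (block v) ≤ ecc graph v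
  eccBound≤ecc v = ℕ.⊔-lub (ecc-≥-last v) (ecc-≥-first v)

  -- Copy a of the first half is paired with copy a of the second half, which makes the sum of the two bounds constant.
  eccBound-pair : ∀ (a : Fin j) → 18 * j ≤ eccBound (a ↑ˡ j) + eccBound (j ↑ʳ a) + 10
  eccBound-pair a = ℕ.+-cancelʳ-≤ (6 * toℕ a) _ _ (begin
    18 * j + 6 * α
      ≡⟨ solve 2 (λ j₁ α → con 18 :* (con 1 :+ j₁) :+ con 6 :* α := con 6 :* (j₁ :+ (con 1 :+ j₁)) :+ con 3 :+ (con 6 :* ((con 1 :+ j₁) :+ α)) :+ con 3) ≡.refl j₁ α ⟩
    top + 6 * (j + α) + 3             ≤⟨ ℕ.+-monoˡ-≤ 3 (ℕ.+-mono-≤ left right) ⟩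
    (6 * α + 5 + l) + (2 + r) + 3
      ≡⟨ solve 3 (λ l r α → (con 6 :* α :+ con 5 :+ l) :+ (con 2 :+ r) :+ con 3 := l :+ r :+ con 10 :+ con 6 :* α) ≡.refl l r α ⟩
    l + r + 10 + 6 * α                ∎)
    where
    open ℕ.≤-Reasoning
    open ℕ-Solver.+-*-Solver
    α = toℕ a
    l = eccBound (a ↑ˡ j)
    r = eccBound (j ↑ʳ a)
    left : top ≤ 6 * α + 5 + l
    left = begin
      top                                                  ≤⟨ ℕ.m≤n+m∸n top (6 * α + 5) ⟩
      6 * α + 5 + (top ∸ (6 * α + 5))                      ≡⟨ ≡.cong (λ i → 6 * α + 5 + (top ∸ (6 * i + 5))) (Fin.toℕ-↑ˡ a j) ⟨
      6 * α + 5 + (top ∸ (6 * toℕ (a ↑ˡ j) + 5))           ≤⟨ ℕ.+-monoʳ-≤ (6 * α + 5) (ℕ.m≤m⊔n _ _) ⟩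
      6 * α + 5 + l                                        ∎
    right : 6 * (j + α) ≤ 2 + r
    right = begin
      6 * (j + α)                     ≤⟨ ℕ.m≤n+m∸n (6 * (j + α)) 2 ⟩
      2 + (6 * (j + α) ∸ 2)           ≡⟨ ≡.cong (λ i → 2 + (6 * i ∸ 2)) (Fin.toℕ-↑ʳ j a) ⟨
      2 + (6 * toℕ (j ↑ʳ a) ∸ 2)      ≤⟨ ℕ.+-monoʳ-≤ 2 (ℕ.m≤n⊔m (top ∸ (6 * toℕ (j ↑ʳ a) + 5)) _) ⟩
      2 + r                           ∎

  -- There are j pairs of copies, each contributing at least 18j - 10.
  sum-eccBound : 18 * j * j ≤ sumFin eccBound + 10 * j
  sum-eccBound = begin
    18 * j * j                                                                     ≡⟨ ℕ.*-comm (18 * j) j ⟩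
    j * (18 * j)                                                                   ≡⟨ sumFin-const j (18 * j) ⟨
    sumFin {j} (λ _ → 18 * j)                                                      ≤⟨ sumFin-mono eccBound-pair ⟩
    sumFin {j} (λ a → eccBound (a ↑ˡ j) + eccBound (j ↑ʳ a) + 10)
      ≡⟨ sumFin-+ {j} (λ a → eccBound (a ↑ˡ j) + eccBound (j ↑ʳ a)) (λ _ → 10) ⟩
    sumFin {j} (λ a → eccBound (a ↑ˡ j) + eccBound (j ↑ʳ a)) + sumFin {j} (λ _ → 10)
      ≡⟨ ≡.cong₂ _+_ (sumFin-+ {j} (λ a → eccBound (a ↑ˡ j)) (λ a → eccBound (j ↑ʳ a))) (sumFin-const j 10) ⟩
    sumFin {j} (λ a → eccBound (a ↑ˡ j)) + sumFin {j} (λ a → eccBound (j ↑ʳ a)) + j * 10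
      ≡⟨ ≡.cong₂ _+_ (≡.sym (sumFin-++ j eccBound)) (ℕ.*-comm j 10) ⟩
    sumFin eccBound + 10 * j                                                       ∎
    where open ℕ.≤-Reasoning

  sumEcc-≥ : blockSize * sumFin eccBound ≤ sumEcc graph
  sumEcc-≥ = begin
    blockSize * sumFin eccBound              ≡⟨ sumFin-quotient k blockSize eccBound ⟨
    sumFin {n} (eccBound ∘ block)            ≤⟨ sumFin-mono {n} eccBound≤ecc ⟩
    sumFin {n} (ecc graph)                   ≡⟨ Distances.sumEcc≡sumFin graph ⟨
    sumEcc graph                             ∎
    where open ℕ.≤-Reasoning

  -- Here n = 2jM with M the order of a copy, so 9n² = 2M · M · 18j². The loss of 10 per pair of
  -- copies becomes 5 after averaging.
  averageEccentricity : 9 * n * n ≤ 2 * blockSize * sumEcc graph + 10 * blockSize * n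
  averageEccentricity = begin
    9 * n * n
      ≡⟨ solve 2 (λ j m → con 9 :* ((j :+ j) :* m) :* ((j :+ j) :* m) := con 2 :* m :* (m :* (con 18 :* j :* j))) ≡.refl j M ⟩
    2 * M * (M * (18 * j * j))                                   ≤⟨ ℕ.*-monoʳ-≤ (2 * M) (ℕ.*-monoʳ-≤ M sum-eccBound) ⟩
    2 * M * (M * (sumFin eccBound + 10 * j))
      ≡⟨ solve 3 (λ j m s → con 2 :* m :* (m :* (s :+ con 10 :* j)) := con 2 :* m :* (m :* s) :+ con 10 :* m :* ((j :+ j) :* m)) ≡.refl j M (sumFin eccBound) ⟩
    2 * M * (M * sumFin eccBound) + 10 * M * n                   ≤⟨ ℕ.+-monoˡ-≤ (10 * M * n) (ℕ.*-monoʳ-≤ (2 * M) sumEcc-≥) ⟩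
    2 * M * sumEcc graph + 10 * M * n                            ∎
    where
    open ℕ.≤-Reasoning
    open ℕ-Solver.+-*-Solver
    M = blockSize

δstar-suc : ∀ q → δstar (suc q) ≡ planeOrder q + planeOrder q
δstar-suc q = begin
  -- Splitting off the summand 2δ shows that the truncated subtraction is exact.
  2 * suc q * suc q ∸ 2 * suc q + 2         ≡⟨ ≡.cong (λ a → a ∸ 2 * suc q + 2) (ℕ.*-suc (2 * suc q) q) ⟩
  2 * suc q + 2 * suc q * q ∸ 2 * suc q + 2 ≡⟨ ≡.cong (_+ 2) (ℕ.m+n∸m≡n (2 * suc q) (2 * suc q * q)) ⟩
  2 * suc q * q + 2
    ≡⟨ solve 1 (λ q → con 2 :* (con 1 :+ q) :* q :+ con 2 := (q :* q :+ (q :+ con 1)) :+ (q :* q :+ (q :+ con 1))) ≡.refl q ⟩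
  planeOrder q + planeOrder q               ∎
  where
  open ≡.≡-Reasoning
  open ℕ-Solver.+-*-Solver

primePower⇒ternaryRing : ∀ {q} → PrimePower q → TernaryRing q
primePower⇒ternaryRing (p , k , pr , 1≤k , ≡.refl) = let K , order≡p^k = finiteField pr 1≤k in
  ≡.subst TernaryRing order≡p^k (Coordinates.ternaryRing K)

¬primePower-0 : ¬ PrimePower 0
¬primePower-0 (p , k , pr , _ , 0≡p^k) = contradiction 0≡p^k (ℕ.<⇒≢ (ℕ.m^n>0 p {{prime⇒nonZero pr}} k))

-- Infinitude is stated as members of arbitrarily large order, and the bound on avec is multiplied
-- through by 2δ*n, with n · avec(G) = `sumEcc G`.
theorem3 : (δ : ℕ) → PrimePower (δ ∸ 1) →
    (N : ℕ) → ∃ λ n → N ≤ n × Σ (Graph n) λ G →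
    Connected G × Bipartite G × C4Free G × MinDegree G δ ×
    9 * n * n ≤ 2 * δstar δ * sumEcc G + 10 * δstar δ * n
-- For δ ≤ 1 the truncated δ ∸ 1 is 0, which is not a prime power.
theorem3 zero          pp N = contradiction pp ¬primePower-0
theorem3 (suc zero)    pp N = contradiction pp ¬primePower-0
theorem3 (suc (suc q)) pp N = k * blockSize , N≤n , graph , connected path , bipartite side side-proper , c4Free edge-C4Free , minDegree ,
    ≡.subst (λ M → 9 * (k * blockSize) * (k * blockSize) ≤ 2 * M * sumEcc graph + 10 * M * (k * blockSize)) (≡.sym (δstar-suc (suc q))) averageEccentricity
  where
  -- Taking N for j₁ gives 2(N + 1) copies, hence more than N vertices.
  open Chain (primePower⇒ternaryRing pp) N
  k = suc N + suc N
  blockSize = planeOrder (suc q) + planeOrder (suc q)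
  N≤n : N ≤ k * blockSize
  N≤n = ℕ.≤-trans (ℕ.≤-trans (ℕ.n≤1+n N) (ℕ.m≤m+n (suc N) (suc N))) (ℕ.m≤m*n k blockSize)
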